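{- Let $N\ge2$ be an integer and $x\in[0,1]\setminus\mathbb{Q}$. The sequences $\omega(x,N)$ and $\widehat\omega(x,N)$ have uniform word frequency. Moreover, every element of $X_{\omega(x,N)}$ and every element of $X_{\widehat\omega(x,N)}$ has uniform word frequency.
   Context: Let $N\ge 1$ be an integer and define $T_N:[0,1]\to[0,1]$ by $T_N(x)=\frac{N}{x}-\lfloor\frac{N}{x}\rfloor$ for $x\ne0$ and $T_N(0)=0$. For $x\in[0,1]\setminus\mathbb{Q}$ the (greedy) NCF digits of $x$ are $d_n=\lfloor N/T_N^{n-1}(x)\rfloor\ge N$, $n\ge1$; one writes $x=[0;d_1,d_2,\ldots]_N$. A substitution on $\{0,1\}$ is given by images of the letters (nonempty words) and extends to finite and infinite words by concatenation. For $x=[0;d_1,d_2,\ldots]_N$ irrational let $\sigma_n(0)=0^{d_n}1^N$, $\sigma_n(1)=0$ and $\widehat\sigma_n(0)=0^{d_n}1$, $\widehat\sigma_n(1)=0^N$ for $n\ge1$. The NCF sequence $\omega(x,N)\in\{0,1\}^{\mathbb N}$ is the unique infinite word $\omega$ for which there exist $\omega^{(1)},\omega^{(2)},\ldots\in\{0,1\}^{\mathbb{N}}$ with $\omega^{(1)}=\omega$ and $\omega^{(n)}=\sigma_n(\omega^{(n+1)})$ for all $n\ge1$. The dual NCF sequence $\widehat\omega(x,N)$ is defined in the same way with $\widehat\sigma_n$ in place of $\sigma_n$. $\{0,1\}^{\mathbb{N}}$ carries the product topology of the discrete topologies, $\Sigma$ is the left shift $\Sigma(\nu_0\nu_1\nu_2\cdots)=\nu_1\nu_2\cdots$,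 and for a sequence $\nu$, $X_\nu=\overline{\{\Sigma^n(\nu):n\in\mathbb{N}\}}$. For words $u,w$, $|w|_u$ denotes the number of occurrences of $u$ in $w$. A sequence $\nu=\nu_0\nu_1\cdots$ has uniform word frequency if for each finite word $u$ there exists $f_\nu(u)\in\mathbb{R}$, which does not depend on $k$, such that $\lim_{l\to\infty}\frac{|\nu_k\cdots\nu_{k+l-1}|_u}{l}=f_\nu(u)$ (for every $k\in\mathbb{N}$). -}

module Defs where

open import Data.Nat as ℕ using (ℕ; zero; suc)
import Data.Nat.Properties as ℕ
open import Data.Integer as ℤ using (ℤ; +_; 1ℤ)
open import Data.Rational as ℚ using (ℚ; 0ℚ; 1ℚ; ½; Positive; positive; nonNegative)
import Data.Rational.Properties as ℚ
open import Algebra.Bundles using (module CommutativeMonoid)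
import Algebra.Properties.CommutativeSemigroup as CommutativeSemigroup
open import Data.Fin using (Fin)
open import Data.Fin.Patterns using (0F; 1F)
open import Data.Fin.Properties using () renaming (_≟_ to _≟ᶠ_)
open import Data.List using (List; []; _∷_; [_]; _++_; length; replicate; concatMap; filter; tails; applyUpTo)
open import Data.List.Relation.Binary.Prefix.Heterogeneous.Properties using (prefix?)
open import Data.Nat.GeneralisedArithmetic using (fold)
open import Data.Product using (∃-syntax; Σ-syntax; _×_; _,_; proj₁; proj₂)
open import Data.Sum using (inj₁; inj₂)
open import Relation.Nullary using (¬_)
open import Relation.Binary.PropositionalEquality using (_≡_; _≗_; refl; sym; trans; cong; subst)

-- Real numbers are Cauchy sequences of rationals, with the setoid
-- equality _≃_ in place of a quotient.

EventuallyWithin : ℚ → (ℕ → ℚ) → Set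
EventuallyWithin ε s = ∃[ M ] ∀ m n → M ℕ.≤ m → M ℕ.≤ n → ℚ.∣ s m ℚ.- s n ∣ ℚ.≤ ε

IsCauchy : (ℕ → ℚ) → Set
IsCauchy s = ∀ ε → 0ℚ ℚ.< ε → EventuallyWithin ε s

record ℝ : Set where
  constructor mkℝ
  field
    seq    : ℕ → ℚ
    cauchy : IsCauchy seq

open ℝ public

module CauchySequences where

  open CommutativeSemigroup (CommutativeMonoid.commutativeSemigroup ℚ.+-0-commutativeMonoid) using (interchange)

  [p-q]+q≡p : ∀ p q → (p ℚ.- q) ℚ.+ q ≡ p
  [p-q]+q≡p p q = trans (ℚ.+-assoc p (ℚ.- q) q)
    (trans (cong (p ℚ.+_) (ℚ.+-inverseˡ q)) (ℚ.+-identityʳ p))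

  [p+q]-q≡p : ∀ p q → (p ℚ.+ q) ℚ.- q ≡ p
  [p+q]-q≡p p q = trans (ℚ.+-assoc p q (ℚ.- q))
    (trans (cong (p ℚ.+_) (ℚ.+-inverseʳ q)) (ℚ.+-identityʳ p))

  neg-involutive : ∀ p → ℚ.- (ℚ.- p) ≡ p
  neg-involutive p = trans (sym ([p+q]-q≡p (ℚ.- (ℚ.- p)) (ℚ.- p)))
    (trans (cong (ℚ._- ℚ.- p) (ℚ.+-inverseˡ (ℚ.- p)))
      (trans (cong (ℚ._- ℚ.- p) (sym (ℚ.+-inverseʳ p))) ([p+q]-q≡p p (ℚ.- p))))

  neg-sub : ∀ p q → ℚ.- (p ℚ.- q) ≡ q ℚ.- p
  neg-sub p q = trans (ℚ.neg-distrib-+ p (ℚ.- q))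
    (trans (cong (ℚ.- p ℚ.+_) (neg-involutive q)) (ℚ.+-comm (ℚ.- p) q))

  telescope : ∀ p q r → (p ℚ.- q) ℚ.+ (q ℚ.- r) ≡ p ℚ.- r
  telescope p q r = trans (sym (ℚ.+-assoc (p ℚ.- q) q (ℚ.- r))) (cong (ℚ._- r) ([p-q]+q≡p p q))

  +-sub : ∀ a b c d → (a ℚ.+ b) ℚ.- (c ℚ.+ d) ≡ (a ℚ.- c) ℚ.+ (b ℚ.- d)
  +-sub a b c d = trans (cong (a ℚ.+ b ℚ.+_) (ℚ.neg-distrib-+ c d))
    (interchange a b (ℚ.- c) (ℚ.- d))

  *-distribˡ-sub : ∀ a b c → a ℚ.* (b ℚ.- c) ≡ a ℚ.* b ℚ.- a ℚ.* c
  *-distribˡ-sub a b c = trans (ℚ.*-distribˡ-+ a b (ℚ.- c))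
    (cong (a ℚ.* b ℚ.+_) (sym (ℚ.neg-distribʳ-* a c)))

  *-sub : ∀ a b c d → a ℚ.* b ℚ.- c ℚ.* d ≡ a ℚ.* (b ℚ.- d) ℚ.+ d ℚ.* (a ℚ.- c)
  *-sub a b c d = sym (trans (cong (ℚ._+ d ℚ.* (a ℚ.- c)) (*-distribˡ-sub a b d))
    (trans (cong (a ℚ.* b ℚ.- a ℚ.* d ℚ.+_) (trans (*-distribˡ-sub d a c)
        (trans (cong (ℚ._- d ℚ.* c) (ℚ.*-comm d a)) (cong (λ r → a ℚ.* d ℚ.- r) (ℚ.*-comm d c)))))
      (telescope (a ℚ.* b) (a ℚ.* d) (c ℚ.* d))))

  const-cauchy : ∀ q → IsCauchy (λ _ → q)
  const-cauchy q ε ε>0 = 0 , λ _ _ _ _ →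
    subst (ℚ._≤ ε) (sym (cong ℚ.∣_∣ (ℚ.+-inverseʳ q))) (ℚ.<⇒≤ ε>0)

  +-cauchy : ∀ {s t} → IsCauchy s → IsCauchy t → IsCauchy (λ n → s n ℚ.+ t n)
  +-cauchy {s} {t} cs ct ε ε>0 = M₁ ℕ.⊔ M₂ , λ m n m≥ n≥ → begin
      ℚ.∣ (s m ℚ.+ t m) ℚ.- (s n ℚ.+ t n) ∣
        ≡⟨ cong ℚ.∣_∣ (+-sub (s m) (t m) (s n) (t n)) ⟩
      ℚ.∣ (s m ℚ.- s n) ℚ.+ (t m ℚ.- t n) ∣
        ≤⟨ ℚ.∣p+q∣≤∣p∣+∣q∣ (s m ℚ.- s n) (t m ℚ.- t n) ⟩
      ℚ.∣ s m ℚ.- s n ∣ ℚ.+ ℚ.∣ t m ℚ.- t n ∣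
        ≤⟨ ℚ.+-mono-≤ (p₁ m n (ℕ.≤-trans (ℕ.m≤m⊔n M₁ M₂) m≥) (ℕ.≤-trans (ℕ.m≤m⊔n M₁ M₂) n≥))
                      (p₂ m n (ℕ.≤-trans (ℕ.m≤n⊔m M₁ M₂) m≥) (ℕ.≤-trans (ℕ.m≤n⊔m M₁ M₂) n≥)) ⟩
      ½ ℚ.* ε ℚ.+ ½ ℚ.* ε
        ≡⟨ trans (sym (ℚ.*-distribʳ-+ ε ½ ½)) (ℚ.*-identityˡ ε) ⟩
      ε ∎
    where
    open ℚ.≤-Reasoning
    ½ε>0 : 0ℚ ℚ.< ½ ℚ.* ε
    ½ε>0 = subst (ℚ._< ½ ℚ.* ε) (ℚ.*-zeroʳ ½) (ℚ.*-monoʳ-<-pos ½ ε>0)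
    M₁ = proj₁ (cs _ ½ε>0)
    p₁ = proj₂ (cs _ ½ε>0)
    M₂ = proj₁ (ct _ ½ε>0)
    p₂ = proj₂ (ct _ ½ε>0)

  neg-cauchy : ∀ {s} → IsCauchy s → IsCauchy (λ n → ℚ.- s n)
  neg-cauchy {s} cs ε ε>0 with cs ε ε>0
  ... | M , p = M , λ m n m≥ n≥ → begin
      ℚ.∣ ℚ.- s m ℚ.- ℚ.- s n ∣
        ≡⟨ cong ℚ.∣_∣ (trans (sym (ℚ.neg-distrib-+ (s m) (ℚ.- s n))) (neg-sub (s m) (s n))) ⟩
      ℚ.∣ s n ℚ.- s m ∣
        ≤⟨ p n m n≥ m≥ ⟩
      ε ∎
    where open ℚ.≤-Reasoning

  ∣p∣-∣q∣≤∣p-q∣ : ∀ p q → ℚ.∣ p ∣ ℚ.- ℚ.∣ q ∣ ℚ.≤ ℚ.∣ p ℚ.- q ∣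
  ∣p∣-∣q∣≤∣p-q∣ p q = begin
      ℚ.∣ p ∣ ℚ.- ℚ.∣ q ∣
        ≡⟨ cong (λ r → ℚ.∣ r ∣ ℚ.- ℚ.∣ q ∣) (sym ([p-q]+q≡p p q)) ⟩
      ℚ.∣ (p ℚ.- q) ℚ.+ q ∣ ℚ.- ℚ.∣ q ∣
        ≤⟨ ℚ.+-monoˡ-≤ (ℚ.- ℚ.∣ q ∣) (ℚ.∣p+q∣≤∣p∣+∣q∣ (p ℚ.- q) q) ⟩
      (ℚ.∣ p ℚ.- q ∣ ℚ.+ ℚ.∣ q ∣) ℚ.- ℚ.∣ q ∣
        ≡⟨ [p+q]-q≡p ℚ.∣ p ℚ.- q ∣ ℚ.∣ q ∣ ⟩
      ℚ.∣ p ℚ.- q ∣ ∎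
    where open ℚ.≤-Reasoning

  ∣p-q∣≡∣q-p∣ : ∀ p q → ℚ.∣ p ℚ.- q ∣ ≡ ℚ.∣ q ℚ.- p ∣
  ∣p-q∣≡∣q-p∣ p q = trans
    (cong ℚ.∣_∣ (sym (neg-sub q p))) (ℚ.∣-p∣≡∣p∣ (q ℚ.- p))

  abs-cauchy : ∀ {s} → IsCauchy s → IsCauchy (λ n → ℚ.∣ s n ∣)
  abs-cauchy {s} cs ε ε>0 with cs ε ε>0
  ... | M , p = M , λ m n m≥ n≥ → bound m n (p m n m≥ n≥)
    where
    bound : ∀ m n → ℚ.∣ s m ℚ.- s n ∣ ℚ.≤ ε → ℚ.∣ ℚ.∣ s m ∣ ℚ.- ℚ.∣ s n ∣ ∣ ℚ.≤ ε
    bound m n le with ℚ.∣p∣≡p∨∣p∣≡-p (ℚ.∣ s m ∣ ℚ.- ℚ.∣ s n ∣)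
    ... | inj₁ eq = subst (ℚ._≤ ε) (sym eq) (ℚ.≤-trans (∣p∣-∣q∣≤∣p-q∣ (s m) (s n)) le)
    ... | inj₂ eq = subst (ℚ._≤ ε)
          (sym (trans eq (neg-sub ℚ.∣ s m ∣ ℚ.∣ s n ∣)))
          (ℚ.≤-trans (∣p∣-∣q∣≤∣p-q∣ (s n) (s m)) (subst (ℚ._≤ ε) (∣p-q∣≡∣q-p∣ (s m) (s n)) le))

  eventuallyBounded : ∀ {s} → IsCauchy s →
    ∃[ B ] 0ℚ ℚ.< B × ∃[ M ] ∀ n → M ℕ.≤ n → ℚ.∣ s n ∣ ℚ.≤ B
  eventuallyBounded {s} cs with cs 1ℚ (ℚ.positive⁻¹ 1ℚ)
  ... | M , p = 1ℚ ℚ.+ ℚ.∣ s M ∣ ,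
      ℚ.+-mono-<-≤ (ℚ.positive⁻¹ 1ℚ) (ℚ.0≤∣p∣ (s M)) ,
      M , λ n n≥ → begin
        ℚ.∣ s n ∣
          ≡⟨ sym ([p-q]+q≡p ℚ.∣ s n ∣ ℚ.∣ s M ∣) ⟩
        (ℚ.∣ s n ∣ ℚ.- ℚ.∣ s M ∣) ℚ.+ ℚ.∣ s M ∣
          ≤⟨ ℚ.+-monoˡ-≤ ℚ.∣ s M ∣ (∣p∣-∣q∣≤∣p-q∣ (s n) (s M)) ⟩
        ℚ.∣ s n ℚ.- s M ∣ ℚ.+ ℚ.∣ s M ∣
          ≤⟨ ℚ.+-monoˡ-≤ ℚ.∣ s M ∣ (p n M n≥ ℕ.≤-refl) ⟩
        1ℚ ℚ.+ ℚ.∣ s M ∣ ∎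
    where open ℚ.≤-Reasoning

  *-mono-≤-∣∣ : ∀ p q {B δ} → 0ℚ ℚ.< B → ℚ.∣ p ∣ ℚ.≤ B → ℚ.∣ q ∣ ℚ.≤ δ →
    ℚ.∣ p ℚ.* q ∣ ℚ.≤ B ℚ.* δ
  *-mono-≤-∣∣ p q {B} {δ} B>0 p≤ q≤ = begin
      ℚ.∣ p ℚ.* q ∣
        ≡⟨ ℚ.∣p*q∣≡∣p∣*∣q∣ p q ⟩
      ℚ.∣ p ∣ ℚ.* ℚ.∣ q ∣
        ≤⟨ ℚ.*-monoʳ-≤-nonNeg ℚ.∣ q ∣ {{ℚ.∣-∣-nonNeg q}} p≤ ⟩
      B ℚ.* ℚ.∣ q ∣
        ≤⟨ ℚ.*-monoˡ-≤-nonNeg B {{nonNegative (ℚ.<⇒≤ B>0)}} q≤ ⟩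
      B ℚ.* δ ∎
    where open ℚ.≤-Reasoning

  *-cauchy : ∀ {s t} → IsCauchy s → IsCauchy t → IsCauchy (λ n → s n ℚ.* t n)
  *-cauchy {s} {t} cs ct ε ε>0 with eventuallyBounded {s} cs | eventuallyBounded {t} ct
  ... | B , B>0 , M , s≤B | C , C>0 , M′ , t≤C =
      (M ℕ.⊔ M′) ℕ.⊔ (M₁ ℕ.⊔ M₂) , λ m n m≥ n≥ → begin
        ℚ.∣ s m ℚ.* t m ℚ.- s n ℚ.* t n ∣
          ≡⟨ cong ℚ.∣_∣ (*-sub (s m) (t m) (s n) (t n)) ⟩
        ℚ.∣ s m ℚ.* (t m ℚ.- t n) ℚ.+ t n ℚ.* (s m ℚ.- s n) ∣
          ≤⟨ ℚ.∣p+q∣≤∣p∣+∣q∣ (s m ℚ.* (t m ℚ.- t n)) (t n ℚ.* (s m ℚ.- s n)) ⟩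
        ℚ.∣ s m ℚ.* (t m ℚ.- t n) ∣ ℚ.+ ℚ.∣ t n ℚ.* (s m ℚ.- s n) ∣
          ≤⟨ ℚ.+-mono-≤
               (*-mono-≤-∣∣ (s m) (t m ℚ.- t n) B>0
                 (s≤B m (ℕ.≤-trans (ℕ.m≤m⊔n M M′) (lower m≥)))
                 (p₂ m n (ℕ.≤-trans (ℕ.m≤n⊔m M₁ M₂) (upper m≥))
                         (ℕ.≤-trans (ℕ.m≤n⊔m M₁ M₂) (upper n≥))))
               (*-mono-≤-∣∣ (t n) (s m ℚ.- s n) C>0
                 (t≤C n (ℕ.≤-trans (ℕ.m≤n⊔m M M′) (lower n≥)))
                 (p₁ m n (ℕ.≤-trans (ℕ.m≤m⊔n M₁ M₂) (upper m≥))
                         (ℕ.≤-trans (ℕ.m≤m⊔n M₁ M₂) (upper n≥)))) ⟩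
        B ℚ.* δ ℚ.+ C ℚ.* δ
          ≡⟨ sym (ℚ.*-distribʳ-+ δ B C) ⟩
        K ℚ.* (ℚ.1/ K ℚ.* ε)
          ≡⟨ sym (ℚ.*-assoc K (ℚ.1/ K) ε) ⟩
        K ℚ.* ℚ.1/ K ℚ.* ε
          ≡⟨ cong (ℚ._* ε) (ℚ.*-inverseʳ K) ⟩
        1ℚ ℚ.* ε
          ≡⟨ ℚ.*-identityˡ ε ⟩
        ε ∎
    where
    open ℚ.≤-Reasoning
    K = B ℚ.+ C
    instance
      K-pos : Positive K
      K-pos = positive (ℚ.+-mono-< B>0 C>0)
      K-nonZero : ℚ.NonZero K
      K-nonZero = ℚ.pos⇒nonZero K
      1/K-pos : Positive (ℚ.1/ K)
      1/K-pos = ℚ.1/pos⇒pos K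
    δ = ℚ.1/ K ℚ.* ε
    δ>0 : 0ℚ ℚ.< δ
    δ>0 = subst (ℚ._< δ) (ℚ.*-zeroʳ (ℚ.1/ K)) (ℚ.*-monoʳ-<-pos (ℚ.1/ K) ε>0)
    M₁ = proj₁ (cs δ δ>0)
    p₁ = proj₂ (cs δ δ>0)
    M₂ = proj₁ (ct δ δ>0)
    p₂ = proj₂ (ct δ δ>0)
    lower : ∀ {m} → (M ℕ.⊔ M′) ℕ.⊔ (M₁ ℕ.⊔ M₂) ℕ.≤ m → M ℕ.⊔ M′ ℕ.≤ m
    lower = ℕ.≤-trans (ℕ.m≤m⊔n (M ℕ.⊔ M′) (M₁ ℕ.⊔ M₂))
    upper : ∀ {m} → (M ℕ.⊔ M′) ℕ.⊔ (M₁ ℕ.⊔ M₂) ℕ.≤ m → M₁ ℕ.⊔ M₂ ℕ.≤ m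
    upper = ℕ.≤-trans (ℕ.m≤n⊔m (M ℕ.⊔ M′) (M₁ ℕ.⊔ M₂))

open CauchySequences

fromℚ : ℚ → ℝ
fromℚ q = mkℝ (λ _ → q) (const-cauchy q)

fromℤ : ℤ → ℝ
fromℤ i = fromℚ (i ℚ./ 1)

0ℝ 1ℝ : ℝ
0ℝ = fromℚ 0ℚ
1ℝ = fromℚ 1ℚ

infixl 7 _*_
infixl 6 _+_ _-_
infix  4 _≃_ _≄_ _≤_ _<_ _⟶_

_+_ : ℝ → ℝ → ℝ
x + y = mkℝ (λ n → seq x n ℚ.+ seq y n) (+-cauchy {seq x} {seq y} (cauchy x) (cauchy y))

-_ : ℝ → ℝ
- x = mkℝ (λ n → ℚ.- seq x n) (neg-cauchy {seq x} (cauchy x))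

_-_ : ℝ → ℝ → ℝ
x - y = x + (- y)

_*_ : ℝ → ℝ → ℝ
x * y = mkℝ (λ n → seq x n ℚ.* seq y n) (*-cauchy {seq x} {seq y} (cauchy x) (cauchy y))

∣_∣ : ℝ → ℝ
∣ x ∣ = mkℝ (λ n → ℚ.∣ seq x n ∣) (abs-cauchy {seq x} (cauchy x))

_≃_ : ℝ → ℝ → Set
x ≃ y = ∀ ε → 0ℚ ℚ.< ε → ∃[ M ] ∀ n → M ℕ.≤ n → ℚ.∣ seq x n ℚ.- seq y n ∣ ℚ.≤ ε

_≄_ : ℝ → ℝ → Set
x ≄ y = ¬ (x ≃ y)

_≤_ : ℝ → ℝ → Set
x ≤ y = ∀ ε → 0ℚ ℚ.< ε → ∃[ M ] ∀ n → M ℕ.≤ n → seq x n ℚ.≤ seq y n ℚ.+ ε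

_<_ : ℝ → ℝ → Set
x < y = ∃[ ε ] 0ℚ ℚ.< ε × ∃[ M ] ∀ n → M ℕ.≤ n → seq x n ℚ.+ ε ℚ.≤ seq y n

Irrational : ℝ → Set
Irrational x = ∀ q → x ≄ fromℚ q

_⟶_ : (ℕ → ℝ) → ℝ → Set
a ⟶ f = ∀ (ε : ℝ) → 0ℝ < ε → ∃[ L ] ∀ l → L ℕ.≤ l → ∣ a l - f ∣ < ε

-- Division, floor and T_N are given by their graphs, since none of them is computable on all Cauchy reals.

IsQuotient : ℝ → ℝ → ℝ → Set
IsQuotient a x z = x ≄ 0ℝ × z * x ≃ a

IsFloor : ℝ → ℤ → Set
IsFloor z i = fromℤ i ≤ z × z < fromℤ (i ℤ.+ 1ℤ)

data TGraph (N : ℕ) (x y : ℝ) : Set where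
  at-nonzero : ∀ z i → IsQuotient (fromℤ (+ N)) x z → IsFloor z i → y ≃ z - fromℤ i → TGraph N x y
  at-zero    : x ≃ 0ℝ → y ≃ 0ℝ → TGraph N x y

-- Digits are indexed from 0: d n is the digit d_{n+1}, and t n is the
-- n-th iterate of T_N at x.
record IsNCFDigits (N : ℕ) (x : ℝ) (d : ℕ → ℕ) : Set where
  field
    t       : ℕ → ℝ
    t-start : t 0 ≃ x
    t-step  : ∀ n → TGraph N (t n) (t (suc n))
    digit   : ∀ n → ∃[ z ] IsQuotient (fromℤ (+ N)) (t n) z × IsFloor z (+ d n)

Letter : Set
Letter = Fin 2

Word : Set
Word = List Letter

Sequence : Set
Sequence = ℕ → Letter

-- factor ν k l is the word ν_k ⋯ ν_{k+l-1}.
factor : Sequence → ℕ → ℕ → Word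
factor ν k l = applyUpTo (λ i → ν (k ℕ.+ i)) l

Substitution : Set
Substitution = Letter → Word

-- IsImage τ ν ω says ω = τ(ν): every τ(ν_0 ⋯ ν_{n-1}) is a prefix of ω.
-- When the images of the letters are nonempty, as they are for σ and σ̂
-- with N ≥ 1, this determines ω.
IsImage : Substitution → Sequence → Sequence → Set
IsImage τ ν ω = ∀ n → let w = concatMap τ (factor ν 0 n) in factor ω 0 (length w) ≡ w

σ : ℕ → ℕ → Substitution
σ N d 0F = replicate d 0F ++ replicate N 1F
σ N d 1F = [ 0F ]

σ̂ : ℕ → ℕ → Substitution
σ̂ N d 0F = replicate d 0F ++ [ 1F ]
σ̂ N d 1F = replicate N 0F

IsDesubstitutable : (ℕ → Substitution) → Sequence → Set
IsDesubstitutable τ ω = Σ[ W ∈ (ℕ → Sequence) ] W 0 ≗ ω × (∀ n → IsImage (τ n) (W (suc n)) (W n))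

-- For irrational x in [0,1] the digits of x, and the sequences below,
-- are uniquely determined.
IsNCFSequence : ℕ → ℝ → Sequence → Set
IsNCFSequence N x ω = ∃[ d ] IsNCFDigits N x d × IsDesubstitutable (λ n → σ N (d n)) ω

IsDualNCFSequence : ℕ → ℝ → Sequence → Set
IsDualNCFSequence N x ω = ∃[ d ] IsNCFDigits N x d × IsDesubstitutable (λ n → σ̂ N (d n)) ω

-- Open sets of the product topology: each point has a neighbourhood
-- within U that restricts only finitely many coordinates.
IsOpen : (Sequence → Set) → Set
IsOpen U = ∀ μ → U μ → ∃[ n ] ∀ μ′ → (∀ i → i ℕ.< n → μ′ i ≡ μ i) → U μ′

Closure : (Sequence → Set) → Sequence → Set₁
Closure A μ = ∀ U → IsOpen U → U μ → ∃[ μ′ ] A μ′ × U μ′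

shift : Sequence → Sequence
shift ν n = ν (suc n)

Orbit : Sequence → Sequence → Set
Orbit ν μ = ∃[ n ] μ ≗ fold ν shift n

X : Sequence → Sequence → Set₁
X ν = Closure (Orbit ν)

∣_∣⟨_⟩ : Word → Word → ℕ
∣ w ∣⟨ u ⟩ = length (filter (prefix? _≟ᶠ_ u) (tails w))

-- The value 0 at l = 0 is a convention that limits do not see.
frequency : Word → Sequence → ℕ → ℕ → ℚ
frequency u ν k zero      = 0ℚ
frequency u ν k l@(suc _) = (+ (∣ factor ν k l ∣⟨ u ⟩)) ℚ./ l

HasUniformWordFrequency : Sequence → Set
HasUniformWordFrequency ν =
  ∀ (u : Word) → ∃[ f ] ∀ (k : ℕ) → (λ l → fromℚ (frequency u ν k l)) ⟶ f

{-# OPTIONS --safe #-}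

-- Let τ_n be the composition of the first n substitutions, a_n the length of τ_n(0), p_n the number of occurrences
-- of u in it, and D(w) = a_n |w|_u − p_n |w|. The number |w|_u is additive in w up to |u| + 1, so D is additive
-- up to O(a_n). By definition D(τ_n(0)) = 0, and D(τ_n(1)) is a 2 × 2 determinant, which the incidence matrix of the
-- next substitution multiplies by −N up to an error O(a_{n+1}). As the digits are at least N, a_{n+1} ≥ N a_n,
-- so |D(τ_n(1))| = O(n a_n). A long factor of the sequence consists of blocks τ_n(0) and τ_n(1) and of two boundary
-- pieces. The blocks have length at least 2^{n-1}, so |w|_u / |w| differs from p_n / a_n by O(n / 2^n) for every
-- sufficiently long factor w: the frequencies are Cauchy uniformly in the position. This passes to the orbit closure,
-- since the factors of its elements are factors of the sequence.

module Submission where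

open import Defs using (Letter; Word; Sequence; Substitution; IsImage; IsDesubstitutable; factor; ∣_∣⟨_⟩; σ; σ̂)
open import Data.Fin.Patterns using (0F; 1F)
open import Data.Fin.Properties using () renaming (_≟_ to _≟ᶠ_)
open import Data.Integer as ℤ using (ℤ; +_; -[1+_]; 1ℤ)
import Data.Integer.Properties as ℤ
import Data.Integer.Tactic.RingSolver as ℤ-Solver
open import Data.List using (List; []; _∷_; [_]; _++_; _∷ʳ_; length; replicate; concatMap; map; tails; applyUpTo)
open import Data.List.Properties hiding (sum-++)
open import Data.List.Relation.Binary.Prefix.Heterogeneous using (Prefix; []; _∷_; _++ᵖ_)
open import Data.List.Relation.Binary.Prefix.Heterogeneous.Properties using (prefix?)
open import Data.Nat as ℕ using (ℕ; zero; suc)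
open import Data.Nat.Coprimality using (Coprime)
open import Data.Nat.GeneralisedArithmetic using (fold)
open import Data.Nat.ListAction using (sum)
open import Data.Nat.ListAction.Properties using (sum-++)
import Data.Nat.Properties as ℕ
import Data.Nat.Tactic.RingSolver as ℕ-Solver
open import Data.Product using (∃-syntax; _×_; _,_; proj₁; proj₂)
open import Data.Rational as ℚ using (ℚ; mkℚ; 0ℚ; 1ℚ; ½; Positive; NonNegative; positive; nonNegative)
import Data.Rational.Properties as ℚ
open import Data.Rational.Solver using (module +-*-Solver)
open import Data.Rational.Unnormalised as ℚᵘ using (mkℚᵘ)
import Data.Rational.Unnormalised.Properties as ℚᵘ
open import Data.Sum using (inj₁; inj₂)
open import Function using (_∘_)
open import Relation.Binary.PropositionalEquality hiding ([_])
open import Relation.Nullary using (¬_; yes; no; contradiction)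

module UniformCounts where

  open import Data.Nat hiding (∣_-_∣)
  open import Data.Nat.Properties
  open import Data.Integer using (∣_∣)
  open ≤-Reasoning

  -- Absolute differences and sums over the letters of a word

  ∣m-n∣≤ : ∀ {m n e} → m ≤ n + e → n ≤ m + e → ∣ + m ℤ.- + n ∣ ≤ e
  ∣m-n∣≤ {m} {n} {e} m≤ n≤ with ≤-total m n
  ... | inj₁ le = begin
    ∣ + m ℤ.- + n ∣ ≡⟨ cong ∣_∣ (ℤ.m-n≡m⊖n m n) ⟩
    ∣ m ℤ.⊖ n ∣     ≡⟨ ℤ.∣⊖∣-≤ le ⟩
    n ∸ m           ≤⟨ m≤n+o⇒m∸n≤o n m n≤ ⟩
    e               ∎
  ... | inj₂ le = begin
    ∣ + m ℤ.- + n ∣ ≡⟨ ℤ.∣i-j∣≡∣j-i∣ (+ m) (+ n) ⟩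
    ∣ + n ℤ.- + m ∣ ≡⟨ cong ∣_∣ (ℤ.m-n≡m⊖n n m) ⟩
    ∣ n ℤ.⊖ m ∣     ≡⟨ ℤ.∣⊖∣-≤ le ⟩
    m ∸ n           ≤⟨ m≤n+o⇒m∸n≤o m n m≤ ⟩
    e               ∎

  ∣i∣≤∣i-j∣+∣j∣ : ∀ i j → ∣ i ∣ ≤ ∣ i ℤ.- j ∣ + ∣ j ∣
  ∣i∣≤∣i-j∣+∣j∣ i j = begin
    ∣ i ∣               ≡⟨ cong ∣_∣ (lemma i j) ⟩
    ∣ i ℤ.- j ℤ.+ j ∣   ≤⟨ ℤ.∣i+j∣≤∣i∣+∣j∣ (i ℤ.- j) j ⟩
    ∣ i ℤ.- j ∣ + ∣ j ∣ ∎
    where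
    lemma : ∀ i j → i ≡ i ℤ.- j ℤ.+ j
    lemma = ℤ-Solver.solve-∀

  -- This depends only on how often each letter occurs in the word. With `length ∘ τ` for h it is
  -- the exact length of τ(w), and with `count ∘ τ` it is the number of occurrences up to those
  -- across block boundaries, so one linear recurrence serves both.
  weight : (Letter → ℕ) → Word → ℕ
  weight h = sum ∘ map h

  weight-++ : ∀ h w v → weight h (w ++ v) ≡ weight h w + weight h v
  weight-++ h w v = trans (cong sum (map-++ h w v)) (sum-++ (map h w) (map h v))

  weight-replicate : ∀ h n c → weight h (replicate n c) ≡ n * h c
  weight-replicate h zero    c = refl
  weight-replicate h (suc n) c = cong (_+_ (h c)) (weight-replicate h n c)

  weight-mono : ∀ {h m} → (∀ c → m ≤ h c) → ∀ w → m * length w ≤ weight h w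
  weight-mono {h} {m} m≤h []      = ≤-reflexive (*-zeroʳ m)
  weight-mono {h} {m} m≤h (c ∷ w) = begin
    m * suc (length w)   ≡⟨ *-suc m (length w) ⟩
    m + m * length w     ≤⟨ +-mono-≤ (m≤h c) (weight-mono m≤h w) ⟩
    h c + weight h w     ∎

  length-concatMap : ∀ (τ : Substitution) w → length (concatMap τ w) ≡ weight (length ∘ τ) w
  length-concatMap τ []      = refl
  length-concatMap τ (c ∷ w) = trans (length-++ (τ c)) (cong (_+_ (length (τ c))) (length-concatMap τ w))

  concatMap-concatMap : ∀ (τ s : Substitution) w → concatMap τ (concatMap s w) ≡ concatMap (concatMap τ ∘ s) w
  concatMap-concatMap τ s []      = refl
  concatMap-concatMap τ s (c ∷ w) = trans (concatMap-++ τ (s c) (concatMap s w))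
    (cong (concatMap τ (s c) ++_) (concatMap-concatMap τ s w))

  -- Counting occurrences

  module Counting (u : Word) where

    count : Word → ℕ
    count w = ∣ w ∣⟨ u ⟩

    U : ℕ
    U = suc (length u)

    -- `tails` ends with the empty word, so there is one more starting position than letters; the
    -- bound is attained for empty u.
    count≤ : ∀ w → count w ≤ suc (length w)
    count≤ w = ≤-trans (length-filter (prefix? _≟ᶠ_ u) (tails w)) (≤-reflexive (length-tails w))
      where
      length-tails : ∀ (w : Word) → length (tails w) ≡ suc (length w)
      length-tails []      = refl
      length-tails (c ∷ w) = cong suc (length-tails w)

    -- An occurrence in w ++ v that begins in w and is not an occurrence in w begins among the last |u| letters of w.
    count-++-≤ : ∀ w v → count (w ++ v) ≤ count w + count v + length w ⊓ length u
    count-++-≤ []      v = ≤-trans (m≤n+m (count v) (count [])) (m≤m+n _ _)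
    count-++-≤ (c ∷ w) v with prefix? _≟ᶠ_ u (c ∷ w ++ v) | prefix? _≟ᶠ_ u (c ∷ w)
    ... | no _  | no _  = ≤-trans (count-++-≤ w v) (+-monoʳ-≤ _ (⊓-monoˡ-≤ (length u) (n≤1+n (length w))))
    ... | no _  | yes _ = m≤n⇒m≤1+n (≤-trans (count-++-≤ w v) (+-monoʳ-≤ _ (⊓-monoˡ-≤ (length u) (n≤1+n (length w)))))
    ... | yes _ | yes _ = s≤s (≤-trans (count-++-≤ w v) (+-monoʳ-≤ _ (⊓-monoˡ-≤ (length u) (n≤1+n (length w)))))
    ... | yes p | no ¬p = begin
      suc (count (w ++ v))                            ≤⟨ s≤s (count-++-≤ w v) ⟩
      suc (count w + count v + length w ⊓ length u)   ≡⟨ +-suc (count w + count v) _ ⟨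
      count w + count v + suc (length w ⊓ length u)   ≤⟨ +-monoʳ-≤ _ (⊓-glb (s≤s (m⊓n≤m (length w) (length u))) (≤-trans (s≤s (m⊓n≤m (length w) (length u))) (short u (c ∷ w) p ¬p))) ⟩
      count w + count v + suc (length w) ⊓ length u   ∎
      where
      short : ∀ (u w : Word) {v} → Prefix _≡_ u (w ++ v) → ¬ Prefix _≡_ u w → length w ≤ length u
      short u       []      p       ¬p = z≤n
      short []      (c ∷ w) p       ¬p = contradiction [] ¬p
      short (b ∷ u) (c ∷ w) (e ∷ p) ¬p = s≤s (short u w p (¬p ∘ (e ∷_)))

    -- Occurrences in w and in v remain occurrences in w ++ v. Only the empty u is counted twice at
    -- the seam, at the end of w and at the start of v; hence `suc`.
    count-++-≥ : ∀ w v → count w + count v ≤ suc (count (w ++ v))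
    count-++-≥ []      v = +-monoˡ-≤ (count v) (count≤ [])
    count-++-≥ (c ∷ w) v with prefix? _≟ᶠ_ u (c ∷ w ++ v) | prefix? _≟ᶠ_ u (c ∷ w)
    ... | no _  | no _  = count-++-≥ w v
    ... | no ¬p | yes p = contradiction (p ++ᵖ v) ¬p
    ... | yes _ | yes _ = s≤s (count-++-≥ w v)
    ... | yes _ | no _  = m≤n⇒m≤1+n (count-++-≥ w v)

    ∣count-++∣≤ : ∀ w v → ∣ + count (w ++ v) ℤ.- + (count w + count v) ∣ ≤ U
    ∣count-++∣≤ w v = ∣m-n∣≤
      (≤-trans (count-++-≤ w v) (+-monoʳ-≤ _ (m≤n⇒m≤1+n (m⊓n≤n (length w) (length u)))))
      (≤-trans (count-++-≥ w v) (≤-trans (s≤s (m≤m+n _ (length u))) (≤-reflexive (sym (+-suc _ _)))))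

    -- Each concatenation costs at most U. The additional U covers the empty word, whose count may
    -- be 1 while its weight is 0.
    ∣count-concatMap∣≤ : ∀ τ w → ∣ + count (concatMap τ w) ℤ.- + weight (count ∘ τ) w ∣ ≤ U * suc (length w)
    ∣count-concatMap∣≤ τ [] = begin
      ∣ + count [] ℤ.- + 0 ∣ ≡⟨ cong ∣_∣ (ℤ.+-identityʳ (+ count [])) ⟩
      count []               ≤⟨ count≤ [] ⟩
      1                      ≤⟨ s≤s z≤n ⟩
      U * 1                  ∎
    ∣count-concatMap∣≤ τ (c ∷ w) = begin
      ∣ + count (τ c ++ v) ℤ.- + (count (τ c) + weight (count ∘ τ) w) ∣
        ≡⟨ cong ∣_∣ (telescope (+ count (τ c ++ v)) (+ count (τ c)) (+ count v) (+ weight (count ∘ τ) w)) ⟩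
      ∣ (+ count (τ c ++ v) ℤ.- + (count (τ c) + count v)) ℤ.+ (+ count v ℤ.- + weight (count ∘ τ) w) ∣
        ≤⟨ ℤ.∣i+j∣≤∣i∣+∣j∣ (+ count (τ c ++ v) ℤ.- + (count (τ c) + count v)) _ ⟩
      ∣ + count (τ c ++ v) ℤ.- + (count (τ c) + count v) ∣ + ∣ + count v ℤ.- + weight (count ∘ τ) w ∣
        ≤⟨ +-mono-≤ (∣count-++∣≤ (τ c) v) (∣count-concatMap∣≤ τ w) ⟩
      U + U * suc (length w)
        ≡⟨ *-suc U (suc (length w)) ⟨
      U * suc (suc (length w)) ∎
      where
      v = concatMap τ w
      telescope : ∀ i j k l → i ℤ.- (j ℤ.+ l) ≡ (i ℤ.- (j ℤ.+ k)) ℤ.+ (k ℤ.- l)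
      telescope = ℤ-Solver.solve-∀

  -- The two substitutions

  -- The field cross≤ bounds the counting errors in the recurrence for the determinant; the factor 5 is not optimal.
  record HasIncidence (N : ℕ) (s : Substitution) : Set where
    field
      x y          : Letter → ℕ
      weight-image : ∀ h c → weight h (s c) ≡ x c * h 0F + y c * h 1F
      ∣det∣≡N      : ∣ + x 0F ℤ.* + y 1F ℤ.- + y 0F ℤ.* + x 1F ∣ ≡ N
      N*≤          : ∀ h → N * h 0F ≤ weight h (s 0F)
      ≤-image      : ∀ h → h 0F ≤ weight h (s 1F)
      cross≤       : ∀ h → suc (length (s 0F)) * weight h (s 1F) + suc (length (s 1F)) * weight h (s 0F)
                           ≤ 5 * N * weight h (s 0F)

  module _ {N d : ℕ} (1≤N : 1 ≤ N) (N≤d : N ≤ d) where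

    private
      instance
        N-nonZero : NonZero N
        N-nonZero = >-nonZero 1≤N
        d-nonZero : NonZero d
        d-nonZero = >-nonZero (≤-trans 1≤N N≤d)

    -- The columns of the incidence matrix are (d, N) and (1, 0), so its determinant is -N. The
    -- growth of the image of 0 comes from its d ≥ N zeros.
    σ-incidence : HasIncidence N (σ N d)
    σ-incidence = record
      { x = λ { 0F → d ; 1F → 1 }
      ; y = λ { 0F → N ; 1F → 0 }
      ; weight-image = λ { h 0F → image h ; h 1F → sym (+-identityʳ _) }
      ; ∣det∣≡N = trans (cong ∣_∣ (det (+ d) (+ N))) (ℤ.∣-i∣≡∣i∣ (+ N))
      ; N*≤ = λ h → begin
          N * h 0F             ≤⟨ *-monoˡ-≤ (h 0F) N≤d ⟩
          d * h 0F             ≤⟨ m≤m+n _ _ ⟩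
          d * h 0F + N * h 1F  ≡⟨ image h ⟨
          weight h (σ N d 0F)  ∎
      ; ≤-image = λ h → m≤m+n (h 0F) 0
      ; cross≤ = cross
      }
      where
      image : ∀ h → weight h (σ N d 0F) ≡ d * h 0F + N * h 1F
      image h = trans (weight-++ h (replicate d 0F) (replicate N 1F))
        (cong₂ _+_ (weight-replicate h d 0F) (weight-replicate h N 1F))
      det : ∀ d N → d ℤ.* + 0 ℤ.- N ℤ.* + 1 ≡ ℤ.- N
      det = ℤ-Solver.solve-∀
      cross : ∀ h → suc (length (σ N d 0F)) * (h 0F + 0) + 2 * weight h (σ N d 0F) ≤ 5 * N * weight h (σ N d 0F)
      cross h = begin
        suc (length (σ N d 0F)) * (h 0F + 0) + 2 * weight h (σ N d 0F)
          ≡⟨ cong₂ (λ l a → suc l * (h 0F + 0) + 2 * a) (trans (length-++ (replicate d 0F)) (cong₂ _+_ (length-replicate d) (length-replicate N))) (image h) ⟩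
        suc (d + N) * (h 0F + 0) + 2 * a
          ≡⟨ expand d N (h 0F) a ⟩
        (d * h 0F + 2 * a) + (N * h 0F + 1 * h 0F)
          -- Since 1 ≤ N ≤ d, each of d h(0), N h(0) and h(0) is at most a; together with 2a this
          -- gives 5a.
          ≤⟨ +-mono-≤ (+-monoˡ-≤ (2 * a) (m≤m+n (d * h 0F) (N * h 1F)))
                      (+-mono-≤ (≤-trans (*-monoˡ-≤ (h 0F) N≤d) (m≤m+n (d * h 0F) (N * h 1F)))
                                (≤-trans (*-monoˡ-≤ (h 0F) (≤-trans 1≤N N≤d)) (m≤m+n (d * h 0F) (N * h 1F)))) ⟩
        (a + 2 * a) + (a + a)
          ≡⟨ collect a ⟩
        5 * a
          ≤⟨ *-monoˡ-≤ a (m≤m*n 5 N) ⟩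
        5 * N * a
          ≡⟨ cong (_*_ (5 * N)) (image h) ⟨
        5 * N * weight h (σ N d 0F) ∎
        where
        a = d * h 0F + N * h 1F
        expand : ∀ d N h a → suc (d + N) * (h + 0) + 2 * a ≡ (d * h + 2 * a) + (N * h + 1 * h)
        expand = ℕ-Solver.solve-∀
        collect : ∀ a → (a + 2 * a) + (a + a) ≡ 5 * a
        collect = ℕ-Solver.solve-∀

    -- The incidence matrix is the transpose of that of σ, with the same determinant -N. The image
    -- of 1 now has N letters, which is where the factor N in `cross≤` comes from.
    σ̂-incidence : HasIncidence N (σ̂ N d)
    σ̂-incidence = record
      { x = λ { 0F → d ; 1F → N }
      ; y = λ { 0F → 1 ; 1F → 0 }
      ; weight-image = λ { h 0F → image h ; h 1F → trans (weight-replicate h N 0F) (sym (+-identityʳ _)) }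
      ; ∣det∣≡N = trans (cong ∣_∣ (det (+ d) (+ N))) (ℤ.∣-i∣≡∣i∣ (+ N))
      ; N*≤ = λ h → begin
          N * h 0F             ≤⟨ *-monoˡ-≤ (h 0F) N≤d ⟩
          d * h 0F             ≤⟨ m≤m+n _ _ ⟩
          d * h 0F + 1 * h 1F  ≡⟨ image h ⟨
          weight h (σ̂ N d 0F)  ∎
      ; ≤-image = λ h → begin
          h 0F                 ≤⟨ m≤n*m (h 0F) N ⟩
          N * h 0F             ≡⟨ weight-replicate h N 0F ⟨
          weight h (σ̂ N d 1F)  ∎
      ; cross≤ = cross
      }
      where
      image : ∀ h → weight h (σ̂ N d 0F) ≡ d * h 0F + 1 * h 1F
      image h = trans (weight-++ h (replicate d 0F) [ 1F ]) (cong (_+ 1 * h 1F) (weight-replicate h d 0F))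
      det : ∀ d N → d ℤ.* + 0 ℤ.- + 1 ℤ.* N ≡ ℤ.- N
      det = ℤ-Solver.solve-∀
      cross : ∀ h → suc (length (σ̂ N d 0F)) * weight h (σ̂ N d 1F) + suc (length (σ̂ N d 1F)) * weight h (σ̂ N d 0F)
              ≤ 5 * N * weight h (σ̂ N d 0F)
      cross h = begin
        suc (length (σ̂ N d 0F)) * weight h (σ̂ N d 1F) + suc (length (σ̂ N d 1F)) * weight h (σ̂ N d 0F)
          ≡⟨ cong₂ _+_
               (cong₂ (λ l b → suc l * b) (trans (length-++ (replicate d 0F)) (cong (_+ 1) (length-replicate d))) (weight-replicate h N 0F))
               (cong₂ (λ l a → suc l * a) (length-replicate N) (image h)) ⟩
        suc (d + 1) * (N * h 0F) + suc N * a
          ≡⟨ expand d N (h 0F) a ⟩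
        N * (d * h 0F + 2 * (1 * h 0F) + a) + 1 * a
          ≤⟨ +-mono-≤ (*-monoʳ-≤ N (+-monoˡ-≤ a (+-mono-≤ (m≤m+n (d * h 0F) (1 * h 1F))
               (*-monoʳ-≤ 2 (≤-trans (*-monoˡ-≤ (h 0F) (≤-trans 1≤N N≤d)) (m≤m+n (d * h 0F) (1 * h 1F)))))))
               (*-monoˡ-≤ a 1≤N) ⟩
        N * (a + 2 * a + a) + N * a
          ≡⟨ collect N a ⟩
        5 * N * a
          ≡⟨ cong (_*_ (5 * N)) (image h) ⟨
        5 * N * weight h (σ̂ N d 0F) ∎
        where
        a = d * h 0F + 1 * h 1F
        expand : ∀ d N h a → suc (d + 1) * (N * h) + suc N * a ≡ N * (d * h + 2 * (1 * h) + a) + 1 * a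
        expand = ℕ-Solver.solve-∀
        collect : ∀ N a → N * (a + 2 * a + a) + N * a ≡ 5 * N * a
        collect = ℕ-Solver.solve-∀

  -- Compositions of the substitutions and the recurrence for the determinant

  -- The newest substitution acts first. Thus a block of level n + 1 is a concatenation of blocks of
  -- level n, and the incidence matrix of `s n` governs the passage between the levels.
  compose : (ℕ → Substitution) → ℕ → Substitution
  compose s zero    = [_]
  compose s (suc n) = concatMap (compose s n) ∘ s n

  module Recurrence (u : Word) where

    open Counting u

    -- Divided by |τ(0)| |w|, this is the deviation of the frequency of u in w from that in τ(0).
    -- Clearing the denominators keeps the estimates in the integers.
    discrepancy : Substitution → Word → ℤ
    discrepancy τ w = + length (τ 0F) ℤ.* + count w ℤ.- + count (τ 0F) ℤ.* + length w

    discrepancy-0 : ∀ τ → discrepancy τ (τ 0F) ≡ + 0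
    discrepancy-0 τ = cancel (+ length (τ 0F)) (+ count (τ 0F))
      where
      cancel : ∀ a p → a ℤ.* p ℤ.- p ℤ.* a ≡ + 0
      cancel = ℤ-Solver.solve-∀

    -- Multiplicativity of the determinant for the product of the matrix with rows (a, b), (p, r)
    -- and the incidence matrix with columns (x₀, y₀), (x₁, y₁).
    weight-det : ∀ x₀ y₀ x₁ y₁ a b p r →
      + (x₀ * a + y₀ * b) ℤ.* + (x₁ * p + y₁ * r) ℤ.- + (x₀ * p + y₀ * r) ℤ.* + (x₁ * a + y₁ * b) ≡
      (+ x₀ ℤ.* + y₁ ℤ.- + y₀ ℤ.* + x₁) ℤ.* (+ a ℤ.* + r ℤ.- + p ℤ.* + b)
    weight-det x₀ y₀ x₁ y₁ a b p r =
      trans (cong₂ ℤ._-_ (cong₂ ℤ._*_ (pos x₀ y₀ a b) (pos x₁ y₁ p r)) (cong₂ ℤ._*_ (pos x₀ y₀ p r) (pos x₁ y₁ a b)))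
        (expand (+ x₀) (+ y₀) (+ x₁) (+ y₁) (+ a) (+ b) (+ p) (+ r))
      where
      pos : ∀ x y a b → + (x * a + y * b) ≡ + x ℤ.* + a ℤ.+ + y ℤ.* + b
      pos x y a b = cong₂ ℤ._+_ (ℤ.pos-* x a) (ℤ.pos-* y b)
      expand : ∀ x₀ y₀ x₁ y₁ a b p r →
        (x₀ ℤ.* a ℤ.+ y₀ ℤ.* b) ℤ.* (x₁ ℤ.* p ℤ.+ y₁ ℤ.* r) ℤ.- (x₀ ℤ.* p ℤ.+ y₀ ℤ.* r) ℤ.* (x₁ ℤ.* a ℤ.+ y₁ ℤ.* b) ≡
        (x₀ ℤ.* y₁ ℤ.- y₀ ℤ.* x₁) ℤ.* (a ℤ.* r ℤ.- p ℤ.* b)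
      expand = ℤ-Solver.solve-∀

    -- Lengths obey the linear recurrence exactly, counts only approximately. With the counts p′, r′
    -- replaced by the weights w₀, w₁, the determinant is multiplied by ±N (`main`); the replacement
    -- costs the counting errors times the lengths, which `cross≤` for `length ∘ τ` controls
    -- (`error`).
    discrepancy-step : ∀ {N s} → HasIncidence N s → ∀ τ → let τ′ = concatMap τ ∘ s in
      ∣ discrepancy τ′ (τ′ 1F) ∣ ≤ N * ∣ discrepancy τ (τ 1F) ∣ + 5 * N * U * length (τ′ 0F)
    discrepancy-step {N} {s} inc τ = begin
      ∣ + a′ ℤ.* + r′ ℤ.- + p′ ℤ.* + b′ ∣
        ≡⟨ cong ∣_∣ (split (+ a′) (+ b′) (+ p′) (+ r′) (+ w₀) (+ w₁)) ⟩
      ∣ (+ a′ ℤ.* + w₁ ℤ.- + w₀ ℤ.* + b′) ℤ.+ ((+ r′ ℤ.- + w₁) ℤ.* + a′ ℤ.- (+ p′ ℤ.- + w₀) ℤ.* + b′) ∣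
        ≤⟨ ℤ.∣i+j∣≤∣i∣+∣j∣ (+ a′ ℤ.* + w₁ ℤ.- + w₀ ℤ.* + b′) _ ⟩
      ∣ + a′ ℤ.* + w₁ ℤ.- + w₀ ℤ.* + b′ ∣ + ∣ (+ r′ ℤ.- + w₁) ℤ.* + a′ ℤ.- (+ p′ ℤ.- + w₀) ℤ.* + b′ ∣
        ≤⟨ +-mono-≤ (≤-reflexive main) error ⟩
      N * ∣ discrepancy τ (τ 1F) ∣ + 5 * N * U * a′ ∎
      where
      open HasIncidence inc
      τ′ = concatMap τ ∘ s
      a′ = length (τ′ 0F)
      b′ = length (τ′ 1F)
      p′ = count (τ′ 0F)
      r′ = count (τ′ 1F)
      w₀ = weight (count ∘ τ) (s 0F)
      w₁ = weight (count ∘ τ) (s 1F)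
      split : ∀ a b p r w₀ w₁ → a ℤ.* r ℤ.- p ℤ.* b ≡
        (a ℤ.* w₁ ℤ.- w₀ ℤ.* b) ℤ.+ ((r ℤ.- w₁) ℤ.* a ℤ.- (p ℤ.- w₀) ℤ.* b)
      split = ℤ-Solver.solve-∀
      length-image : ∀ c → length (τ′ c) ≡ x c * length (τ 0F) + y c * length (τ 1F)
      length-image c = trans (length-concatMap τ (s c)) (weight-image (length ∘ τ) c)
      main : ∣ + a′ ℤ.* + w₁ ℤ.- + w₀ ℤ.* + b′ ∣ ≡ N * ∣ discrepancy τ (τ 1F) ∣
      main = begin-equality
        ∣ + a′ ℤ.* + w₁ ℤ.- + w₀ ℤ.* + b′ ∣
          ≡⟨ cong ∣_∣ (cong₂ ℤ._-_
               (cong₂ (λ m n → + m ℤ.* + n) (length-image 0F) (weight-image (count ∘ τ) 1F))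
               (cong₂ (λ m n → + m ℤ.* + n) (weight-image (count ∘ τ) 0F) (length-image 1F))) ⟩
        _
          ≡⟨ cong ∣_∣ (weight-det (x 0F) (y 0F) (x 1F) (y 1F) _ _ _ _) ⟩
        ∣ (+ x 0F ℤ.* + y 1F ℤ.- + y 0F ℤ.* + x 1F) ℤ.* discrepancy τ (τ 1F) ∣
          ≡⟨ ℤ.∣i*j∣≡∣i∣*∣j∣ (+ x 0F ℤ.* + y 1F ℤ.- + y 0F ℤ.* + x 1F) _ ⟩
        ∣ + x 0F ℤ.* + y 1F ℤ.- + y 0F ℤ.* + x 1F ∣ * ∣ discrepancy τ (τ 1F) ∣
          ≡⟨ cong (_* ∣ discrepancy τ (τ 1F) ∣) ∣det∣≡N ⟩
        N * ∣ discrepancy τ (τ 1F) ∣ ∎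
      error : ∣ (+ r′ ℤ.- + w₁) ℤ.* + a′ ℤ.- (+ p′ ℤ.- + w₀) ℤ.* + b′ ∣ ≤ 5 * N * U * a′
      error = begin
        ∣ (+ r′ ℤ.- + w₁) ℤ.* + a′ ℤ.- (+ p′ ℤ.- + w₀) ℤ.* + b′ ∣
          ≤⟨ ℤ.∣i-j∣≤∣i∣+∣j∣ ((+ r′ ℤ.- + w₁) ℤ.* + a′) _ ⟩
        ∣ (+ r′ ℤ.- + w₁) ℤ.* + a′ ∣ + ∣ (+ p′ ℤ.- + w₀) ℤ.* + b′ ∣
          ≡⟨ cong₂ _+_ (ℤ.∣i*j∣≡∣i∣*∣j∣ (+ r′ ℤ.- + w₁) (+ a′)) (ℤ.∣i*j∣≡∣i∣*∣j∣ (+ p′ ℤ.- + w₀) (+ b′)) ⟩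
        ∣ + r′ ℤ.- + w₁ ∣ * a′ + ∣ + p′ ℤ.- + w₀ ∣ * b′
          ≤⟨ +-mono-≤ (*-monoˡ-≤ a′ (∣count-concatMap∣≤ τ (s 1F))) (*-monoˡ-≤ b′ (∣count-concatMap∣≤ τ (s 0F))) ⟩
        U * suc (length (s 1F)) * a′ + U * suc (length (s 0F)) * b′
          ≡⟨ collect U (suc (length (s 1F))) a′ (suc (length (s 0F))) b′ ⟩
        U * (suc (length (s 0F)) * b′ + suc (length (s 1F)) * a′)
          ≤⟨ *-monoʳ-≤ U (subst₂ (λ a b → suc (length (s 0F)) * b + suc (length (s 1F)) * a ≤ 5 * N * a)
               (sym (length-concatMap τ (s 0F))) (sym (length-concatMap τ (s 1F))) (cross≤ (length ∘ τ))) ⟩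
        U * (5 * N * a′)
          ≡⟨ reassoc U N a′ ⟩
        5 * N * U * a′ ∎
        where
        collect : ∀ U m a n b → U * m * a + U * n * b ≡ U * (n * b + m * a)
        collect = ℕ-Solver.solve-∀
        reassoc : ∀ U N a → U * (5 * N * a) ≡ 5 * N * U * a
        reassoc = ℕ-Solver.solve-∀

    module _ {N : ℕ} {s : ℕ → Substitution} (inc : ∀ n → HasIncidence N (s n)) where

      -- The factor N of each step is absorbed by the growth N a_n ≤ a_{n+1} of the lengths.
      -- Relative to the length, a step therefore only adds 5 N U, and the bound is linear in n.
      ∣discrepancy-1∣≤ : ∀ n → let τ = compose s n in
        ∣ discrepancy τ (τ 1F) ∣ ≤ (5 * N * n + 4) * U * length (τ 0F)
      ∣discrepancy-1∣≤ zero = begin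
        ∣ discrepancy [_] [ 1F ] ∣                ≤⟨ ℤ.∣i-j∣≤∣i∣+∣j∣ (+ 1 ℤ.* + count [ 1F ]) (+ count [ 0F ] ℤ.* + 1) ⟩
        ∣ + 1 ℤ.* + count [ 1F ] ∣ + ∣ + count [ 0F ] ℤ.* + 1 ∣
          ≡⟨ cong₂ (λ i j → ∣ i ∣ + ∣ j ∣) (ℤ.*-identityˡ (+ count [ 1F ])) (ℤ.*-identityʳ (+ count [ 0F ])) ⟩
        -- Each one-letter word has two tails, so each count is at most 2; this is the constant 4 of
        -- the bound.
        count [ 1F ] + count [ 0F ]               ≤⟨ +-mono-≤ (count≤ [ 1F ]) (count≤ [ 0F ]) ⟩
        4                                         ≤⟨ m≤n+m 4 (5 * N * 0) ⟩
        5 * N * 0 + 4                             ≤⟨ m≤m*n _ U ⟩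
        (5 * N * 0 + 4) * U                       ≡⟨ *-identityʳ _ ⟨
        (5 * N * 0 + 4) * U * 1                   ∎
      ∣discrepancy-1∣≤ (suc n) = begin
        ∣ discrepancy τ′ (τ′ 1F) ∣
          ≤⟨ discrepancy-step (inc n) τ ⟩
        N * ∣ discrepancy τ (τ 1F) ∣ + 5 * N * U * length (τ′ 0F)
          ≤⟨ +-monoˡ-≤ _ (*-monoʳ-≤ N (∣discrepancy-1∣≤ n)) ⟩
        N * ((5 * N * n + 4) * U * length (τ 0F)) + 5 * N * U * length (τ′ 0F)
          ≡⟨ cong (_+ 5 * N * U * length (τ′ 0F)) (*-swap N ((5 * N * n + 4) * U) (length (τ 0F))) ⟩
        (5 * N * n + 4) * U * (N * length (τ 0F)) + 5 * N * U * length (τ′ 0F)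
          ≤⟨ +-monoˡ-≤ _ (*-monoʳ-≤ ((5 * N * n + 4) * U) (subst (N * length (τ 0F) ≤_) (sym (length-concatMap τ (s n 0F))) (HasIncidence.N*≤ (inc n) (length ∘ τ)))) ⟩
        (5 * N * n + 4) * U * length (τ′ 0F) + 5 * N * U * length (τ′ 0F)
          ≡⟨ collect N n U (length (τ′ 0F)) ⟩
        (5 * N * suc n + 4) * U * length (τ′ 0F) ∎
        where
        τ  = compose s n
        τ′ = compose s (suc n)
        *-swap : ∀ m n o → m * (n * o) ≡ n * (m * o)
        *-swap = ℕ-Solver.solve-∀
        collect : ∀ N n U a → (5 * N * n + 4) * U * a + 5 * N * U * a ≡ (5 * N * suc n + 4) * U * a
        collect = ℕ-Solver.solve-∀

  -- The image of 0 grows at least by the factor N ≥ 2. The image of 1 is at least as long as the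
  -- image of 0 one level earlier; the factor 2 on the right pays for this delay.
  compose-length≥ : ∀ {N s} → 2 ≤ N → (∀ n → HasIncidence N (s n)) → ∀ n c → 2 ^ n ≤ 2 * length (compose s n c)
  compose-length≥ {N} {s} 2≤N inc n = λ { 0F → ≤-trans (proj₁ (both n)) (m≤n*m _ 2) ; 1F → proj₂ (both n) }
    where
    both : ∀ n → 2 ^ n ≤ length (compose s n 0F) × 2 ^ n ≤ 2 * length (compose s n 1F)
    both zero    = s≤s z≤n , s≤s z≤n
    both (suc n) =
      (begin
        2 * 2 ^ n                          ≤⟨ *-mono-≤ 2≤N (proj₁ (both n)) ⟩
        N * length (τ 0F)                  ≤⟨ HasIncidence.N*≤ (inc n) (length ∘ τ) ⟩
        weight (length ∘ τ) (s n 0F)       ≡⟨ length-concatMap τ (s n 0F) ⟨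
        length (compose s (suc n) 0F)      ∎) ,
      *-monoʳ-≤ 2 (begin
        2 ^ n                              ≤⟨ proj₁ (both n) ⟩
        length (τ 0F)                      ≤⟨ HasIncidence.≤-image (inc n) (length ∘ τ) ⟩
        weight (length ∘ τ) (s n 1F)       ≡⟨ length-concatMap τ (s n 1F) ⟨
        length (compose s (suc n) 1F)      ∎)
      where τ = compose s n

  -- Initial segments of sequences

  applyUpTo-cong : ∀ {A : Set} {f g : ℕ → A} n → (∀ {i} → i < n → f i ≡ g i) → applyUpTo f n ≡ applyUpTo g n
  applyUpTo-cong zero    f≡g = refl
  applyUpTo-cong (suc n) f≡g = cong₂ _∷_ (f≡g (s≤s z≤n)) (applyUpTo-cong n (f≡g ∘ s≤s))

  applyUpTo-+ : ∀ {A : Set} (f : ℕ → A) m n → applyUpTo f (m + n) ≡ applyUpTo f m ++ applyUpTo (λ i → f (m + i)) n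
  applyUpTo-+ f zero    n = refl
  applyUpTo-+ f (suc m) n = cong (f 0 ∷_) (applyUpTo-+ (f ∘ suc) m n)

  applyUpTo-cancel : ∀ {A : Set} (f : ℕ → A) v {w n} → applyUpTo f (length v) ≡ v → applyUpTo f (length v + n) ≡ v ++ w →
    applyUpTo (λ i → f (length v + i)) n ≡ w
  applyUpTo-cancel f v {w} {n} v-eq vw-eq = ++-cancelˡ v _ _
    (trans (cong (_++ applyUpTo (λ i → f (length v + i)) n) (sym v-eq)) (trans (sym (applyUpTo-+ f (length v) n)) vw-eq))

  -- Images under substitutions

  IsImage-id : ∀ ν → IsImage [_] ν ν
  IsImage-id ν n = subst (λ w → applyUpTo ν (length w) ≡ w) (sym (concatMap-pure (applyUpTo ν n)))
    (cong (applyUpTo ν) (length-applyUpTo ν n))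

  IsImage-∘ : ∀ {τ s ν′ ν ω} → IsImage τ ν ω → IsImage s ν′ ν → IsImage (concatMap τ ∘ s) ν′ ω
  IsImage-∘ {τ} {s} {ν′} {ν} {ω} τ-image s-image n =
    subst (λ w → applyUpTo ω (length w) ≡ w)
      (trans (cong (concatMap τ) (s-image n)) (concatMap-concatMap τ s (applyUpTo ν′ n)))
      -- At this length `s-image` identifies the initial segment of ν with the image under s of the
      -- first n letters of ν′.
      (τ-image (length (concatMap s (applyUpTo ν′ n))))

  compose-image : ∀ {s ω} ((W , _) : IsDesubstitutable s ω) → ∀ n → IsImage (compose s n) (W n) (W 0)
  compose-image (W , W₀≗ω , images) zero    = IsImage-id (W 0)
  compose-image {s} (W , W₀≗ω , images) (suc n) = IsImage-∘ {compose s n} (compose-image (W , W₀≗ω , images) n) (images n)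

  -- This moves the origin to a block boundary, so that factors at arbitrary positions can be
  -- treated like initial segments.
  IsImage-drop : ∀ {τ ν ω} → IsImage τ ν ω → ∀ j →
    IsImage τ (λ i → ν (j + i)) (λ i → ω (length (concatMap τ (applyUpTo ν j)) + i))
  IsImage-drop {τ} {ν} {ω} image j n = applyUpTo-cancel ω v (image j)
    (trans (cong (applyUpTo ω) (sym (length-++ v))) (subst (λ z → applyUpTo ω (length z) ≡ z) split (image (j + n))))
    where
    v = concatMap τ (applyUpTo ν j)
    w = concatMap τ (applyUpTo (λ i → ν (j + i)) n)
    split : concatMap τ (applyUpTo ν (j + n)) ≡ v ++ w
    split = trans (cong (concatMap τ) (applyUpTo-+ ν j n)) (concatMap-++ τ (applyUpTo ν j) _)

  module _ {τ : Substitution} {M : ℕ} (1≤τ : ∀ c → 1 ≤ length (τ c)) (τ≤M : ∀ c → length (τ c) ≤ M) where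

    decompose : ∀ {ν ω} → IsImage τ ν ω → ∀ l → ∃[ r ] ∃[ v ] applyUpTo ω l ≡ concatMap τ (applyUpTo ν r) ++ v × length v ≤ M
    decompose {ν} {ω} image l = let r , v , eq , v< = go l in r , v , eq , ≤-trans (<⇒≤ v<) (τ≤M _)
      where
      -- The sequence is read letter by letter. The invariant is that the remainder v is strictly
      -- shorter than the current block τ(ν r); the empty remainder satisfies it because blocks are
      -- nonempty.
      go : ∀ l → ∃[ r ] ∃[ v ] applyUpTo ω l ≡ concatMap τ (applyUpTo ν r) ++ v × length v < length (τ (ν r))
      go zero = 0 , [] , refl , 1≤τ (ν 0)
      go (suc l) with r , v , eq , v< ← go l with m≤n⇒m<n∨m≡n v<
      ... | inj₁ v′< = r , v ∷ʳ ω l ,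
        trans (sym (applyUpTo-∷ʳ ω l)) (trans (cong (_∷ʳ ω l) eq) (++-assoc (concatMap τ (applyUpTo ν r)) v _)) ,
        subst (_< length (τ (ν r))) (sym (trans (length-++ v) (+-comm (length v) 1))) v′<
      -- The block is now complete: the image condition at `suc r` describes the whole initial
      -- segment, and the remainder starts again empty.
      ... | inj₂ v′≡ = suc r , [] ,
        trans (cong (applyUpTo ω) (sym len)) (trans (image (suc r)) (sym (++-identityʳ _))) , 1≤τ (ν (suc r))
        where
        x = concatMap τ (applyUpTo ν r)
        len : length (concatMap τ (applyUpTo ν (suc r))) ≡ suc l
        len = begin-equality
          length (concatMap τ (applyUpTo ν (suc r)))    ≡⟨ cong (length ∘ concatMap τ) (applyUpTo-∷ʳ ν r) ⟨
          length (concatMap τ (applyUpTo ν r ∷ʳ ν r))   ≡⟨ cong length (concatMap-++ τ (applyUpTo ν r) [ ν r ]) ⟩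
          length (x ++ (τ (ν r) ++ []))                 ≡⟨ length-++ x ⟩
          length x + length (τ (ν r) ++ [])             ≡⟨ cong (λ w → length x + length w) (++-identityʳ (τ (ν r))) ⟩
          length x + length (τ (ν r))                   ≡⟨ cong (_+_ (length x)) v′≡ ⟨
          length x + suc (length v)                     ≡⟨ +-suc (length x) (length v) ⟩
          suc (length x + length v)                     ≡⟨ cong suc (length-++ x) ⟨
          suc (length (x ++ v))                         ≡⟨ cong (suc ∘ length) eq ⟨
          suc (length (applyUpTo ω l))                  ≡⟨ cong suc (length-applyUpTo ω l) ⟩
          suc l                                         ∎

    -- The word x consists of the letters between the last block boundary up to position k and k
    -- itself. Prolonged by x, the factor starts at a block boundary, and `decompose` applies to the
    -- shifted sequences.
    decompose-factor : ∀ {ν ω} → IsImage τ ν ω → ∀ k l →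
      ∃[ x ] ∃[ w ] ∃[ v ] x ++ factor ω k l ≡ concatMap τ w ++ v × length x ≤ M × length v ≤ M
    decompose-factor {ν} {ω} image k l
      with j , x , k-eq , x≤M ← decompose image k
      with r , v , eq , v≤M ← decompose (IsImage-drop {τ} image j) (length x + l)
      = x , applyUpTo (λ i → ν (j + i)) r , v , trans (sym (trans (applyUpTo-+ _ (length x) l) (cong₂ _++_ x-eq tail-eq))) eq , x≤M , v≤M
      where
      y = concatMap τ (applyUpTo ν j)
      k≡ : k ≡ length y + length x
      k≡ = trans (sym (length-applyUpTo ω k)) (trans (cong length k-eq) (length-++ y))
      x-eq : applyUpTo (λ i → ω (length y + i)) (length x) ≡ x
      x-eq = applyUpTo-cancel ω y (image j) (trans (cong (applyUpTo ω) (sym k≡)) k-eq)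
      tail-eq : applyUpTo (λ i → ω (length y + (length x + i))) l ≡ factor ω k l
      tail-eq = applyUpTo-cong l (λ {i} _ → cong ω (trans (sym (+-assoc (length y) _ i)) (cong (_+ i) (sym k≡))))

  -- The discrepancy of long factors

  module Discrepancy (u : Word) (τ : Substitution) where

    open Counting u
    open Recurrence u

    a p : ℕ
    a = length (τ 0F)
    p = count (τ 0F)

    D : Word → ℤ
    D = discrepancy τ

    -- Length is exactly additive, so only the count contributes an error, at most U, and it enters
    -- D with the factor a.
    ∣D-++∣ : ∀ w v → ∣ D (w ++ v) ℤ.- (D w ℤ.+ D v) ∣ ≤ a * U
    ∣D-++∣ w v = begin
      ∣ D (w ++ v) ℤ.- (D w ℤ.+ D v) ∣
        ≡⟨ cong (λ n → ∣ + a ℤ.* + count (w ++ v) ℤ.- + p ℤ.* + n ℤ.- (D w ℤ.+ D v) ∣) (length-++ w) ⟩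
      _
        ≡⟨ cong ∣_∣ (simplify (+ a) (+ p) (+ count (w ++ v)) (+ count w) (+ count v) (+ length w) (+ length v)) ⟩
      ∣ + a ℤ.* (+ count (w ++ v) ℤ.- + (count w + count v)) ∣
        ≡⟨ ℤ.∣i*j∣≡∣i∣*∣j∣ (+ a) (+ count (w ++ v) ℤ.- + (count w + count v)) ⟩
      a * ∣ + count (w ++ v) ℤ.- + (count w + count v) ∣
        ≤⟨ *-monoʳ-≤ a (∣count-++∣≤ w v) ⟩
      a * U ∎
      where
      simplify : ∀ a p c d e m n → a ℤ.* c ℤ.- p ℤ.* (m ℤ.+ n) ℤ.- ((a ℤ.* d ℤ.- p ℤ.* m) ℤ.+ (a ℤ.* e ℤ.- p ℤ.* n))
        ≡ a ℤ.* (c ℤ.- (d ℤ.+ e))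
      simplify = ℤ-Solver.solve-∀

    ∣D-++∣≤ : ∀ w v → ∣ D (w ++ v) ∣ ≤ a * U + (∣ D w ∣ + ∣ D v ∣)
    ∣D-++∣≤ w v = ≤-trans (∣i∣≤∣i-j∣+∣j∣ (D (w ++ v)) (D w ℤ.+ D v)) (+-mono-≤ (∣D-++∣ w v) (ℤ.∣i+j∣≤∣i∣+∣j∣ (D w) (D v)))

    ∣D-suffix∣≤ : ∀ w v → ∣ D v ∣ ≤ a * U + (∣ D (w ++ v) ∣ + ∣ D w ∣)
    ∣D-suffix∣≤ w v = begin
      ∣ D v ∣
        ≤⟨ ∣i∣≤∣i-j∣+∣j∣ (D v) (D (w ++ v) ℤ.- D w) ⟩
      ∣ D v ℤ.- (D (w ++ v) ℤ.- D w) ∣ + ∣ D (w ++ v) ℤ.- D w ∣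
        ≤⟨ +-mono-≤ (≤-reflexive (trans (cong ∣_∣ (swap (D v) (D (w ++ v)) (D w))) (ℤ.∣-i∣≡∣i∣ (D (w ++ v) ℤ.- (D w ℤ.+ D v)))))
                    (ℤ.∣i-j∣≤∣i∣+∣j∣ (D (w ++ v)) (D w)) ⟩
      ∣ D (w ++ v) ℤ.- (D w ℤ.+ D v) ∣ + (∣ D (w ++ v) ∣ + ∣ D w ∣)
        ≤⟨ +-monoˡ-≤ _ (∣D-++∣ w v) ⟩
      a * U + (∣ D (w ++ v) ∣ + ∣ D w ∣) ∎
      where
      swap : ∀ i j k → i ℤ.- (j ℤ.- k) ≡ ℤ.- (j ℤ.- (k ℤ.+ i))
      swap = ℤ-Solver.solve-∀

    -- A crude bound for the boundary pieces, whose length does not grow with the factor.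
    ∣D∣≤ : ∀ w → ∣ D w ∣ ≤ (a + p) * suc (length w)
    ∣D∣≤ w = begin
      ∣ D w ∣                                        ≤⟨ ℤ.∣i-j∣≤∣i∣+∣j∣ (+ a ℤ.* + count w) (+ p ℤ.* + length w) ⟩
      ∣ + a ℤ.* + count w ∣ + ∣ + p ℤ.* + length w ∣ ≡⟨ cong₂ _+_ (ℤ.∣i*j∣≡∣i∣*∣j∣ (+ a) (+ count w)) (ℤ.∣i*j∣≡∣i∣*∣j∣ (+ p) (+ length w)) ⟩
      a * count w + p * length w                     ≤⟨ +-mono-≤ (*-monoʳ-≤ a (count≤ w)) (*-monoʳ-≤ p (n≤1+n (length w))) ⟩
      a * suc (length w) + p * suc (length w)        ≡⟨ *-distribʳ-+ (suc (length w)) a p ⟨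
      (a + p) * suc (length w)                       ∎

    module _ {β : ℕ} (D-block : ∀ c → ∣ D (τ c) ∣ ≤ β * a) where

      -- Each block contributes at most β a and each seam a U. The additional summand covers the
      -- empty word, which counts once if u is empty.
      ∣D-concatMap∣≤ : ∀ w → ∣ D (concatMap τ w) ∣ ≤ suc (length w) * ((β + U) * a)
      ∣D-concatMap∣≤ [] = begin
        ∣ D [] ∣              ≡⟨ cong ∣_∣ (zero-length (+ a) (+ count []) (+ p)) ⟩
        ∣ + a ℤ.* + count [] ∣ ≡⟨ ℤ.∣i*j∣≡∣i∣*∣j∣ (+ a) (+ count []) ⟩
        a * count []          ≤⟨ *-monoʳ-≤ a (count≤ []) ⟩
        a * 1                 ≤⟨ *-monoʳ-≤ a (≤-trans (s≤s z≤n) (m≤n+m U β)) ⟩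
        a * (β + U)           ≡⟨ *-comm a (β + U) ⟩
        (β + U) * a           ≡⟨ *-identityˡ _ ⟨
        1 * ((β + U) * a)     ∎
        where
        zero-length : ∀ a c p → a ℤ.* c ℤ.- p ℤ.* + 0 ≡ a ℤ.* c
        zero-length = ℤ-Solver.solve-∀
      ∣D-concatMap∣≤ (c ∷ w) = begin
        ∣ D (τ c ++ concatMap τ w) ∣
          ≤⟨ ∣D-++∣≤ (τ c) (concatMap τ w) ⟩
        a * U + (∣ D (τ c) ∣ + ∣ D (concatMap τ w) ∣)
          ≤⟨ +-monoʳ-≤ (a * U) (+-mono-≤ (D-block c) (∣D-concatMap∣≤ w)) ⟩
        a * U + (β * a + suc (length w) * ((β + U) * a))
          ≡⟨ collect a U β (suc (length w)) ⟩
        suc (suc (length w)) * ((β + U) * a) ∎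
        where
        collect : ∀ a U β n → a * U + (β * a + n * ((β + U) * a)) ≡ suc n * ((β + U) * a)
        collect = ℕ-Solver.solve-∀

      module _ {m M : ℕ} (1≤m : 1 ≤ m) (m≤τ : ∀ c → m ≤ length (τ c)) (τ≤M : ∀ c → length (τ c) ≤ M) where

        -- Blocks have length at least m, so a factor of length l prolonged by x contains at most (M
        -- + l) / m of them; multiplying by m avoids the division. The constant K is chosen before
        -- the sequences, k and l, which makes the estimate uniform in the position.
        ∣D-factor∣≤ : ∃[ K ] ∀ {ν ω} → IsImage τ ν ω → ∀ k l → m * ∣ D (factor ω k l) ∣ ≤ l * ((β + U) * a) + K
        -- The term m B is the additional summand of `∣D-concatMap∣≤`, and M B accounts for the
        -- prolongation by x. The boundary pieces x and v cost K₁ each, and splitting them off costs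
        -- a U each.
        ∣D-factor∣≤ = (m + M) * B + m * (K₁ + K₁ + (a * U + a * U)) , λ {ν} {ω} → bound {ν} {ω}
          where
          B K₁ : ℕ
          B  = (β + U) * a
          K₁ = (a + p) * suc M
          bound : ∀ {ν ω} → IsImage τ ν ω → ∀ k l → m * ∣ D (factor ω k l) ∣ ≤ l * B + ((m + M) * B + m * (K₁ + K₁ + (a * U + a * U)))
          bound {ν} {ω} image k l with x , w , v , eq , x≤M , v≤M ← decompose-factor (λ c → ≤-trans 1≤m (m≤τ c)) τ≤M {ν} image k l = begin
            m * ∣ D (factor ω k l) ∣
              ≤⟨ *-monoʳ-≤ m (∣D-suffix∣≤ x (factor ω k l)) ⟩
            m * (a * U + (∣ D (x ++ factor ω k l) ∣ + ∣ D x ∣))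
              ≤⟨ *-monoʳ-≤ m (+-monoʳ-≤ (a * U) (+-mono-≤ D-whole (short x x≤M))) ⟩
            m * (a * U + (a * U + (suc (length w) * B + K₁) + K₁))
              ≡⟨ expand m a U (length w) B K₁ ⟩
            m * length w * B + (m * B + m * (K₁ + K₁ + (a * U + a * U)))
              ≤⟨ +-monoˡ-≤ _ (*-monoˡ-≤ B blocks) ⟩
            (M + l) * B + (m * B + m * (K₁ + K₁ + (a * U + a * U)))
              ≡⟨ collect m M l B (K₁ + K₁ + (a * U + a * U)) ⟩
            l * B + ((m + M) * B + m * (K₁ + K₁ + (a * U + a * U))) ∎
            where
            short : ∀ z → length z ≤ M → ∣ D z ∣ ≤ K₁
            short z z≤M = ≤-trans (∣D∣≤ z) (*-monoʳ-≤ (a + p) (s≤s z≤M))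
            D-whole : ∣ D (x ++ factor ω k l) ∣ ≤ a * U + (suc (length w) * B + K₁)
            D-whole = subst (λ z → ∣ D z ∣ ≤ _) (sym eq)
              (≤-trans (∣D-++∣≤ (concatMap τ w) v) (+-monoʳ-≤ (a * U) (+-mono-≤ (∣D-concatMap∣≤ w) (short v v≤M))))
            blocks : m * length w ≤ M + l
            blocks = begin
              m * length w                        ≤⟨ weight-mono m≤τ w ⟩
              weight (length ∘ τ) w               ≡⟨ length-concatMap τ w ⟨
              length (concatMap τ w)              ≤⟨ m≤m+n _ (length v) ⟩
              length (concatMap τ w) + length v   ≡⟨ length-++ (concatMap τ w) ⟨
              length (concatMap τ w ++ v)         ≡⟨ cong length eq ⟨
              length (x ++ factor ω k l)          ≡⟨ length-++ x ⟩
              length x + length (factor ω k l)    ≤⟨ +-mono-≤ x≤M (≤-reflexive (length-applyUpTo _ l)) ⟩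
              M + l                               ∎
            expand : ∀ m a U n B K → m * (a * U + (a * U + (suc n * B + K) + K)) ≡ m * n * B + (m * B + m * (K + K + (a * U + a * U)))
            expand = ℕ-Solver.solve-∀
            collect : ∀ m M l B K → (M + l) * B + (m * B + m * K) ≡ l * B + ((m + M) * B + m * K)
            collect = ℕ-Solver.solve-∀

  -- Agreement of the frequencies in long factors

  -- With t = 2Q and n = 2t, the left side is at most t (t + 1), and both factors are at most 2^t.
  linear≤exponential : ∀ Q → ∃[ n ] Q * suc n ≤ 2 ^ n
  linear≤exponential Q = t + t , (begin
    Q * suc (t + t)         ≤⟨ *-monoʳ-≤ Q (s≤s (+-monoʳ-≤ t (n≤1+n t))) ⟩
    Q * (suc t + suc t)     ≡⟨ double Q (suc t) ⟩
    t * suc t               ≤⟨ *-mono-≤ (≤-trans (n≤1+n t) (n<2^n t)) (n<2^n t) ⟩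
    2 ^ t * 2 ^ t           ≡⟨ ^-distribˡ-+-* 2 t t ⟨
    2 ^ (t + t)             ∎)
    where
    t = Q + Q
    double : ∀ Q n → Q * (n + n) ≡ (Q + Q) * n
    double = ℕ-Solver.solve-∀
    n<2^n : ∀ n → suc n ≤ 2 ^ n
    n<2^n zero    = s≤s z≤n
    n<2^n (suc n) = begin
      suc (suc n)       ≤⟨ s≤s (m≤n+m (suc n) n) ⟩
      suc n + suc n     ≡⟨ cong (_+_ (suc n)) (+-identityʳ (suc n)) ⟨
      2 * suc n         ≤⟨ *-monoʳ-≤ 2 (n<2^n n) ⟩
      2 * 2 ^ n         ∎

  module _ (u : Word) where

    open Counting u
    open Recurrence u

    -- With denominators cleared: the frequencies in two long factors differ by at most 2 / R. The 2
    -- stems from comparing each of them with the same quotient p / a.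
    FrequenciesAgree : Sequence → Set
    FrequenciesAgree ω = ∀ R → ∃[ L ] ∀ k k′ l l′ → L ≤ l → L ≤ l′ →
      R * ∣ + count (factor ω k l) ℤ.* + l′ ℤ.- + count (factor ω k′ l′) ℤ.* + l ∣ ≤ 2 * (l * l′)

    desubstitutable⇒frequenciesAgree : ∀ {N s ω} → 2 ≤ N → (∀ n → HasIncidence N (s n)) →
      ((W , _) : IsDesubstitutable s ω) → FrequenciesAgree (W 0)
    desubstitutable⇒frequenciesAgree {N} {s} {ω} 2≤N inc desub@(W , _) R
      with n , Q≤2^n ← linear≤exponential (R * (5 * N * U + 5 * U + 1)) = K , agree
      where
      τ : Substitution
      -- Level `suc n` is taken because `compose-length≥` loses a factor 2; the blocks then have
      -- length at least 2^n, which the choice of n makes at least R (γ + 1).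
      τ = compose s (suc n)
      open Discrepancy u τ using (a; p; D; ∣D-factor∣≤)
      β γ m M : ℕ
      β = (5 * N * suc n + 4) * U
      γ = β + U
      m = 2 ^ n
      M = length (τ 0F) + length (τ 1F)
      m≤τ : ∀ c → m ≤ length (τ c)
      m≤τ c = *-cancelˡ-≤ 2 (compose-length≥ 2≤N inc (suc n) c)
      τ≤M : ∀ c → length (τ c) ≤ M
      τ≤M 0F = m≤m+n _ _
      τ≤M 1F = m≤n+m _ _
      D-block : ∀ c → ∣ D (τ c) ∣ ≤ β * a
      D-block 0F = ≤-trans (≤-reflexive (cong ∣_∣ (discrepancy-0 τ))) z≤n
      D-block 1F = ∣discrepancy-1∣≤ inc (suc n)
      estimate = ∣D-factor∣≤ {β} D-block (m^n>0 2 n) m≤τ τ≤M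
      K : ℕ
      K = proj₁ estimate
      instance
        m-nonZero : NonZero m
        m-nonZero = >-nonZero (m^n>0 2 n)
        a-nonZero : NonZero a
        a-nonZero = >-nonZero (≤-trans (m^n>0 2 n) (m≤τ 0F))
      R*sucγ≤m : R * suc γ ≤ m
      R*sucγ≤m = begin
        R * suc γ                                  ≤⟨ *-monoʳ-≤ R slack ⟩
        R * ((5 * N * U + 5 * U + 1) * suc n)      ≡⟨ *-assoc R _ (suc n) ⟨
        R * (5 * N * U + 5 * U + 1) * suc n        ≤⟨ Q≤2^n ⟩
        m                                          ∎
        where
        expand : ∀ N n U → suc ((5 * N * suc n + 4) * U + U) + (5 * U * n + n) ≡ (5 * N * U + 5 * U + 1) * suc n
        expand = ℕ-Solver.solve-∀
        slack : suc γ ≤ (5 * N * U + 5 * U + 1) * suc n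
        slack = ≤-trans (m≤m+n (suc γ) (5 * U * n + n)) (≤-reflexive (expand N n U))
      small : ∀ k l → K ≤ l → R * ∣ D (factor (W 0) k l) ∣ ≤ l * a
      small k l K≤l = *-cancelˡ-≤ m (begin
        m * (R * ∣ D (factor (W 0) k l) ∣)   ≡⟨ *-swap m R _ ⟩
        R * (m * ∣ D (factor (W 0) k l) ∣)   ≤⟨ *-monoʳ-≤ R (proj₂ estimate {W (suc n)} (compose-image desub (suc n)) k l) ⟩
        -- The constant K also serves as the threshold for l: it is absorbed into l a, which turns γ
        -- into γ + 1.
        R * (l * (γ * a) + K)                ≤⟨ *-monoʳ-≤ R (+-monoʳ-≤ (l * (γ * a)) (≤-trans K≤l (m≤m*n l a))) ⟩
        R * (l * (γ * a) + l * a)            ≡⟨ collect R l γ a ⟩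
        R * suc γ * (l * a)                  ≤⟨ *-monoˡ-≤ (l * a) R*sucγ≤m ⟩
        m * (l * a)                          ∎)
        where
        *-swap : ∀ m n o → m * (n * o) ≡ n * (m * o)
        *-swap = ℕ-Solver.solve-∀
        collect : ∀ R l γ a → R * (l * (γ * a) + l * a) ≡ R * suc γ * (l * a)
        collect = ℕ-Solver.solve-∀
      agree : ∀ k k′ l l′ → K ≤ l → K ≤ l′ →
        R * ∣ + count (factor (W 0) k l) ℤ.* + l′ ℤ.- + count (factor (W 0) k′ l′) ℤ.* + l ∣ ≤ 2 * (l * l′)
      -- After multiplication by a, the terms with p cancel and aΔ becomes D f · l′ - D f′ · l, so
      -- `small` applies to both factors.
      agree k k′ l l′ K≤l K≤l′ = *-cancelˡ-≤ a (begin
        a * (R * ∣ Δ ∣)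
          ≡⟨ *-swap a R _ ⟩
        R * (a * ∣ Δ ∣)
          ≡⟨ cong (_*_ R) (ℤ.∣i*j∣≡∣i∣*∣j∣ (+ a) Δ) ⟨
        R * ∣ + a ℤ.* Δ ∣
          ≡⟨ cong (λ i → R * ∣ i ∣) (trans (eliminate (+ a) (+ p) (+ count f) (+ l) (+ count f′) (+ l′))
               (cong₂ (λ i j → (+ a ℤ.* + count f ℤ.- + p ℤ.* + i) ℤ.* + l′ ℤ.- (+ a ℤ.* + count f′ ℤ.- + p ℤ.* + j) ℤ.* + l)
                 (sym (length-applyUpTo _ l)) (sym (length-applyUpTo _ l′)))) ⟩
        R * ∣ D f ℤ.* + l′ ℤ.- D f′ ℤ.* + l ∣
          ≤⟨ *-monoʳ-≤ R (ℤ.∣i-j∣≤∣i∣+∣j∣ (D f ℤ.* + l′) _) ⟩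
        R * (∣ D f ℤ.* + l′ ∣ + ∣ D f′ ℤ.* + l ∣)
          ≡⟨ cong (_*_ R) (cong₂ _+_ (ℤ.∣i*j∣≡∣i∣*∣j∣ (D f) (+ l′)) (ℤ.∣i*j∣≡∣i∣*∣j∣ (D f′) (+ l))) ⟩
        R * (∣ D f ∣ * l′ + ∣ D f′ ∣ * l)
          ≡⟨ distrib R (∣ D f ∣) l′ (∣ D f′ ∣) l ⟩
        R * ∣ D f ∣ * l′ + R * ∣ D f′ ∣ * l
          ≤⟨ +-mono-≤ (*-monoˡ-≤ l′ (small k l K≤l)) (*-monoˡ-≤ l (small k′ l′ K≤l′)) ⟩
        l * a * l′ + l′ * a * l
          ≡⟨ collect a l l′ ⟩
        a * (2 * (l * l′)) ∎)
        where
        f  = factor (W 0) k l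
        f′ = factor (W 0) k′ l′
        Δ : ℤ
        Δ = + count f ℤ.* + l′ ℤ.- + count f′ ℤ.* + l
        *-swap : ∀ m n o → m * (n * o) ≡ n * (m * o)
        *-swap = ℕ-Solver.solve-∀
        eliminate : ∀ a p c l c′ l′ → a ℤ.* (c ℤ.* l′ ℤ.- c′ ℤ.* l) ≡
          (a ℤ.* c ℤ.- p ℤ.* l) ℤ.* l′ ℤ.- (a ℤ.* c′ ℤ.- p ℤ.* l′) ℤ.* l
        eliminate = ℤ-Solver.solve-∀
        distrib : ∀ R x l′ y l → R * (x * l′ + y * l) ≡ R * x * l′ + R * y * l
        distrib = ℕ-Solver.solve-∀
        collect : ∀ a l l′ → l * a * l′ + l′ * a * l ≡ a * (2 * (l * l′))
        collect = ℕ-Solver.solve-∀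

open UniformCounts using
  (HasIncidence; σ-incidence; σ̂-incidence; applyUpTo-cong; FrequenciesAgree; desubstitutable⇒frequenciesAgree)
open import Defs
open CauchySequences using (∣p-q∣≡∣q-p∣)

½ε>0 : ∀ {ε} → 0ℚ ℚ.< ε → 0ℚ ℚ.< ½ ℚ.* ε
½ε>0 {ε} ε>0 = subst (ℚ._< ½ ℚ.* ε) (ℚ.*-zeroʳ ½) (ℚ.*-monoʳ-<-pos ½ ε>0)

½ε+½ε≡ε : ∀ ε → ½ ℚ.* ε ℚ.+ ½ ℚ.* ε ≡ ε
½ε+½ε≡ε ε = trans (sym (ℚ.*-distribʳ-+ ε ½ ½)) (ℚ.*-identityˡ ε)

-- Frequencies of words

-- Cross multiplication bounds the difference by 1 / (d + 1), hence by (n + 1) / (d + 1). The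
-- comparison takes place in unnormalised rationals because `_/_` reduces fractions.
∣c/l-c′/l′∣≤ : ∀ c c′ l l′ n d .{d-coprime : Coprime (suc n) (suc d)} →
  suc d ℕ.* ℤ.∣ + c ℤ.* + suc l′ ℤ.- + c′ ℤ.* + suc l ∣ ℕ.≤ suc l ℕ.* suc l′ →
  ℚ.∣ + c ℚ./ suc l ℚ.- + c′ ℚ./ suc l′ ∣ ℚ.≤ mkℚ (+ suc n) d d-coprime
∣c/l-c′/l′∣≤ c c′ l l′ n d le = ℚ.toℚᵘ-cancel-≤ (ℚᵘ.≤-respˡ-≃ (ℚᵘ.≃-sym unnormalise) (ℚᵘ.*≤* bound))
  where
  q  = + c ℚ./ suc l
  q′ = + c′ ℚ./ suc l′
  unnormalise : ℚ.toℚᵘ ℚ.∣ q ℚ.- q′ ∣ ℚᵘ.≃ ℚᵘ.∣ mkℚᵘ (+ c) l ℚᵘ.- mkℚᵘ (+ c′) l′ ∣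
  unnormalise = ℚᵘ.≃-trans (ℚ.toℚᵘ-homo-∣-∣ (q ℚ.- q′)) (ℚᵘ.∣-∣-cong
    (ℚᵘ.≃-trans (ℚ.toℚᵘ-homo-+ q (ℚ.- q′)) (ℚᵘ.+-cong (ℚ.toℚᵘ-fromℚᵘ (mkℚᵘ (+ c) l))
      (ℚᵘ.≃-trans (ℚ.toℚᵘ-homo‿- q′) (ℚᵘ.-‿cong (ℚ.toℚᵘ-fromℚᵘ (mkℚᵘ (+ c′) l′)))))))
  open ℤ.≤-Reasoning
  m = ℤ.∣ + c ℤ.* + suc l′ ℤ.+ (ℤ.- + c′) ℤ.* + suc l ∣
  bound : + m ℤ.* + suc d ℤ.≤ + suc n ℤ.* + (suc l ℕ.* suc l′)
  bound = begin
    + m ℤ.* + suc d              ≡⟨ ℤ.pos-* m (suc d) ⟨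
    + (m ℕ.* suc d)              ≤⟨ ℤ.+≤+ (ℕ.≤-trans (ℕ.≤-reflexive (trans (ℕ.*-comm m (suc d)) (cong (λ i → suc d ℕ.* ℤ.∣ + c ℤ.* + suc l′ ℤ.+ i ∣) (sym (ℤ.neg-distribˡ-* (+ c′) (+ suc l))))))
                                      (ℕ.≤-trans le (ℕ.m≤n*m _ (suc n)))) ⟩
    + (suc n ℕ.* (suc l ℕ.* suc l′)) ≡⟨ ℤ.pos-* (suc n) _ ⟩
    + suc n ℤ.* + (suc l ℕ.* suc l′) ∎

UniformlyCauchyFrequencies : Word → Sequence → Set
UniformlyCauchyFrequencies u ω = ∀ ε → 0ℚ ℚ.< ε → ∃[ L ] ∀ k k′ l l′ → L ℕ.≤ l → L ℕ.≤ l′ →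
  ℚ.∣ frequency u ω k l ℚ.- frequency u ω k′ l′ ∣ ℚ.≤ ε

frequenciesAgree⇒uniformlyCauchy : ∀ {u ω} → FrequenciesAgree u ω → UniformlyCauchyFrequencies u ω
frequenciesAgree⇒uniformlyCauchy agree (mkℚ (+ 0) d _)      (ℚ.*<* (ℤ.+<+ ()))
frequenciesAgree⇒uniformlyCauchy agree (mkℚ -[1+ n ] d _)   (ℚ.*<* ())
-- With R = 2 (d + 1) the difference 2 / R is 1 / (d + 1). The threshold `suc L` excludes length 0
-- and its default frequency.
frequenciesAgree⇒uniformlyCauchy {u} {ω} agree (mkℚ (+ suc n) d _) _ with L , within ← agree (2 ℕ.* suc d) = suc L , bound
  where
  bound : ∀ k k′ l l′ → suc L ℕ.≤ l → suc L ℕ.≤ l′ → ℚ.∣ frequency u ω k l ℚ.- frequency u ω k′ l′ ∣ ℚ.≤ mkℚ (+ suc n) d _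
  bound k k′ (suc l) (suc l′) L<l L<l′ = ∣c/l-c′/l′∣≤ ∣ factor ω k (suc l) ∣⟨ u ⟩ ∣ factor ω k′ (suc l′) ∣⟨ u ⟩ l l′ n d
    (ℕ.*-cancelˡ-≤ 2 (subst (ℕ._≤ 2 ℕ.* (suc l ℕ.* suc l′)) (ℕ.*-assoc 2 (suc d) _)
      (within k k′ (suc l) (suc l′) (ℕ.<⇒≤ L<l) (ℕ.<⇒≤ L<l′))))

-- This relation treats ω itself and the elements of its orbit closure alike.
FactorsOf : Sequence → Sequence → Set
FactorsOf ω μ = ∀ k l → ∃[ k′ ] factor μ k l ≡ factor ω k′ l

frequency-cong : ∀ u {μ ω k k′} l → factor μ k l ≡ factor ω k′ l → frequency u μ k l ≡ frequency u ω k′ l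
frequency-cong u zero    eq = refl
frequency-cong u (suc l) eq = cong (λ w → + ∣ w ∣⟨ u ⟩ ℚ./ suc l) eq

-- The limit is read off from the initial segments of ω. As the Cauchy condition is uniform in the
-- position, it is also the limit along any choice of factors of ω, in particular along those of μ
-- at each k.
uniformlyCauchy⇒uniformWordFrequency : ∀ {ω} → (∀ u → UniformlyCauchyFrequencies u ω) →
  ∀ {μ} → FactorsOf ω μ → HasUniformWordFrequency μ
uniformlyCauchy⇒uniformWordFrequency {ω} uc {μ} factors u = f , limit
  where
  f : ℝ
  f = mkℝ (frequency u ω 0) (λ ε ε>0 → let L , within = uc u ε ε>0 in L , within 0 0)
  limit : ∀ k → (λ l → fromℚ (frequency u μ k l)) ⟶ f
  -- The rational δ witnesses 0 < ε. One half of it bounds the difference, the other half is the gap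
  -- that the strict inequality of reals demands.
  limit k ε (δ , δ>0 , M , δ≤ε) = let L , within = uc u (½ ℚ.* δ) (½ε>0 δ>0) in
    L , λ l L≤l → ½ ℚ.* δ , ½ε>0 δ>0 , M ℕ.⊔ L , λ n n≥ → let k′ , eq = factors k l in begin
      ℚ.∣ frequency u μ k l ℚ.- frequency u ω 0 n ∣ ℚ.+ ½ ℚ.* δ
        ≡⟨ cong (λ q → ℚ.∣ q ℚ.- frequency u ω 0 n ∣ ℚ.+ ½ ℚ.* δ) (frequency-cong u l eq) ⟩
      ℚ.∣ frequency u ω k′ l ℚ.- frequency u ω 0 n ∣ ℚ.+ ½ ℚ.* δ
        ≤⟨ ℚ.+-monoˡ-≤ (½ ℚ.* δ) (within k′ 0 l n L≤l (ℕ.≤-trans (ℕ.m≤n⊔m M L) n≥)) ⟩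
      ½ ℚ.* δ ℚ.+ ½ ℚ.* δ
        ≡⟨ ½ε+½ε≡ε δ ⟩
      δ
        ≡⟨ ℚ.+-identityˡ δ ⟨
      0ℚ ℚ.+ δ
        ≤⟨ δ≤ε n (ℕ.≤-trans (ℕ.m≤m⊔n M L) n≥) ⟩
      seq ε n ∎
    where open ℚ.≤-Reasoning

-- The closure is tested on the cylinder of sequences that agree with μ in the first k + l letters.
-- It contains a shift of ω by some n, so the factor of μ at k is the factor of ω at n + k.
orbit-closure-factors : ∀ {ω μ} → X ω μ → FactorsOf ω μ
orbit-closure-factors {ω} {μ} μ∈X k l
  with μ′ , (n , μ′≗) , near ← μ∈X (λ ν → ∀ i → i ℕ.< k ℕ.+ l → ν i ≡ μ i)
         (λ ν ν≡μ → k ℕ.+ l , λ ν′ ν′≡ν i i< → trans (ν′≡ν i i<) (ν≡μ i i<)) (λ _ _ → refl)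
  = n ℕ.+ k , applyUpTo-cong l (λ {i} i<l → trans (sym (near (k ℕ.+ i) (ℕ.+-monoʳ-< k i<l)))
      (trans (μ′≗ (k ℕ.+ i)) (trans (fold-shift n (k ℕ.+ i)) (cong ω (sym (ℕ.+-assoc n k i))))))
  where
  fold-shift : ∀ n i → fold ω shift n i ≡ ω (n ℕ.+ i)
  fold-shift zero    i = refl
  fold-shift (suc n) i = trans (fold-shift n (suc i)) (cong ω (ℕ.+-suc n i))

-- Digits

p≤∣p∣ : ∀ p → p ℚ.≤ ℚ.∣ p ∣
p≤∣p∣ (mkℚ (+ n)    d c) = ℚ.≤-refl
p≤∣p∣ p@(mkℚ -[1+ n ] d c) = ℚ.≤-trans (ℚ.nonPositive⁻¹ p) (ℚ.0≤∣p∣ p)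

∣p-q∣≤ε⇒p≤q+ε : ∀ p q {ε} → ℚ.∣ p ℚ.- q ∣ ℚ.≤ ε → p ℚ.≤ q ℚ.+ ε
∣p-q∣≤ε⇒p≤q+ε p q {ε} le = begin
  p                 ≡⟨ solve 2 (λ p q → p := q :+ (p :- q)) refl p q ⟩
  q ℚ.+ (p ℚ.- q)   ≤⟨ ℚ.+-monoʳ-≤ q (ℚ.≤-trans (p≤∣p∣ (p ℚ.- q)) le) ⟩
  q ℚ.+ ε           ∎
  where
  open ℚ.≤-Reasoning
  open +-*-Solver

≃-sym : ∀ {x y} → x ≃ y → y ≃ x
≃-sym {x} {y} x≃y ε ε>0 with M , within ← x≃y ε ε>0 =
  M , λ n n≥ → subst (ℚ._≤ ε) (∣p-q∣≡∣q-p∣ (seq x n) (seq y n)) (within n n≥)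

≃⇒≤ : ∀ {x y} → x ≃ y → x ≤ y
≃⇒≤ {x} {y} x≃y ε ε>0 with M , within ← x≃y ε ε>0 = M , λ n n≥ → ∣p-q∣≤ε⇒p≤q+ε (seq x n) (seq y n) (within n n≥)

≤-trans : ∀ {x y z} → x ≤ y → y ≤ z → x ≤ z
≤-trans {x} {y} {z} x≤y y≤z ε ε>0
  with M , p ← x≤y (½ ℚ.* ε) (½ε>0 ε>0) with M′ , q ← y≤z (½ ℚ.* ε) (½ε>0 ε>0) = M ℕ.⊔ M′ , λ n n≥ → begin
    seq x n                                 ≤⟨ p n (ℕ.≤-trans (ℕ.m≤m⊔n M M′) n≥) ⟩
    seq y n ℚ.+ ½ ℚ.* ε                     ≤⟨ ℚ.+-monoˡ-≤ (½ ℚ.* ε) (q n (ℕ.≤-trans (ℕ.m≤n⊔m M M′) n≥)) ⟩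
    seq z n ℚ.+ ½ ℚ.* ε ℚ.+ ½ ℚ.* ε         ≡⟨ ℚ.+-assoc (seq z n) _ _ ⟩
    seq z n ℚ.+ (½ ℚ.* ε ℚ.+ ½ ℚ.* ε)       ≡⟨ cong (λ q → seq z n ℚ.+ q) (½ε+½ε≡ε ε) ⟩
    seq z n ℚ.+ ε                           ∎
  where open ℚ.≤-Reasoning

fromℤ-suc : ∀ i → (i ℤ.+ 1ℤ) ℚ./ 1 ≡ i ℚ./ 1 ℚ.+ 1ℚ
fromℤ-suc i = ℚ.toℚᵘ-injective (ℚᵘ.≃-trans (ℚ.toℚᵘ-fromℚᵘ (mkℚᵘ (i ℤ.+ 1ℤ) 0)) (ℚᵘ.≃-trans
  (ℚᵘ.*≡* (cong (ℤ._* 1ℤ) (cong (ℤ._+ 1ℤ) (sym (ℤ.*-identityʳ i)))))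
  (ℚᵘ.≃-trans (ℚᵘ.+-congˡ (mkℚᵘ 1ℤ 0) (ℚᵘ.≃-sym (ℚ.toℚᵘ-fromℚᵘ (mkℚᵘ i 0)))) (ℚᵘ.≃-sym (ℚ.toℚᵘ-homo-+ (i ℚ./ 1) 1ℚ)))))

i≤j⇒i/1≤j/1 : ∀ i j → i ℤ.≤ j → i ℚ./ 1 ℚ.≤ j ℚ./ 1
i≤j⇒i/1≤j/1 i j i≤j = ℚ.toℚᵘ-cancel-≤ (ℚᵘ.≤-respˡ-≃ (ℚᵘ.≃-sym (ℚ.toℚᵘ-fromℚᵘ (mkℚᵘ i 0)))
  (ℚᵘ.≤-respʳ-≃ (ℚᵘ.≃-sym (ℚ.toℚᵘ-fromℚᵘ (mkℚᵘ j 0))) (ℚᵘ.*≤* (ℤ.*-monoʳ-≤-nonNeg 1ℤ i≤j))))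

InUnitInterval : ℝ → Set
InUnitInterval x = 0ℝ ≤ x × x ≤ 1ℝ

InUnitInterval-resp : ∀ {x y} → x ≃ y → InUnitInterval x → InUnitInterval y
InUnitInterval-resp {x} {y} x≃y (0≤x , x≤1) =
  ≤-trans {0ℝ} {x} {y} 0≤x (≃⇒≤ {x} {y} x≃y) ,
  ≤-trans {y} {x} {1ℝ} (≃⇒≤ {y} {x} (≃-sym {x} {y} x≃y)) x≤1

fractional-part : ∀ z i → IsFloor z i → InUnitInterval (z - fromℤ i)
fractional-part z i (i≤z , (δ , δ>0 , M′ , z+δ≤)) =
  (λ ε ε>0 → let M , i≤z+ε = i≤z ε ε>0 in M , λ n n≥ → begin
    0ℚ                                  ≡⟨ ℚ.+-inverseʳ (i ℚ./ 1) ⟨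
    i ℚ./ 1 ℚ.- i ℚ./ 1                 ≤⟨ ℚ.+-monoˡ-≤ (ℚ.- (i ℚ./ 1)) (i≤z+ε n n≥) ⟩
    seq z n ℚ.+ ε ℚ.- i ℚ./ 1           ≡⟨ solve 3 (λ z ε i → z :+ ε :- i := z :- i :+ ε) refl (seq z n) ε (i ℚ./ 1) ⟩
    seq z n ℚ.- i ℚ./ 1 ℚ.+ ε           ∎) ,
  (λ ε ε>0 → M′ , λ n n≥ → begin
    seq z n ℚ.- i ℚ./ 1                 ≡⟨ ℚ.+-identityʳ _ ⟨
    seq z n ℚ.- i ℚ./ 1 ℚ.+ 0ℚ          ≤⟨ ℚ.+-monoʳ-≤ (seq z n ℚ.- i ℚ./ 1) (ℚ.<⇒≤ δ>0) ⟩
    seq z n ℚ.- i ℚ./ 1 ℚ.+ δ           ≡⟨ solve 3 (λ z ε i → z :- i :+ ε := z :+ ε :- i) refl (seq z n) δ (i ℚ./ 1) ⟩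
    seq z n ℚ.+ δ ℚ.- i ℚ./ 1           ≤⟨ ℚ.+-monoˡ-≤ (ℚ.- (i ℚ./ 1)) (z+δ≤ n n≥) ⟩
    (i ℤ.+ 1ℤ) ℚ./ 1 ℚ.- i ℚ./ 1        ≡⟨ cong (ℚ._- i ℚ./ 1) (fromℤ-suc i) ⟩
    i ℚ./ 1 ℚ.+ 1ℚ ℚ.- i ℚ./ 1          ≡⟨ solve 2 (λ i o → i :+ o :- i := o) refl (i ℚ./ 1) 1ℚ ⟩
    1ℚ                                  ≡⟨ ℚ.+-identityʳ 1ℚ ⟨
    1ℚ ℚ.+ 0ℚ                           ≤⟨ ℚ.+-monoʳ-≤ 1ℚ (ℚ.<⇒≤ ε>0) ⟩
    1ℚ ℚ.+ ε                            ∎)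
  where
  open ℚ.≤-Reasoning
  open +-*-Solver

TGraph-unitInterval : ∀ {N x y} → TGraph N x y → InUnitInterval y
TGraph-unitInterval {y = y} (at-nonzero z i _ floor y≃) =
  InUnitInterval-resp {z - fromℤ i} {y} (≃-sym {y} {z - fromℤ i} y≃) (fractional-part z i floor)
TGraph-unitInterval {y = y} (at-zero _ y≃0) = InUnitInterval-resp {0ℝ} {y} (≃-sym {y} {0ℝ} y≃0)
  ((λ ε ε>0 → 0 , λ _ _ → ℚ.<⇒≤ (subst (0ℚ ℚ.<_) (sym (ℚ.+-identityˡ ε)) ε>0)) ,
   (λ ε ε>0 → 0 , λ _ _ → ℚ.<⇒≤ (ℚ.+-mono-< (ℚ.positive⁻¹ 1ℚ) ε>0)))

iterates-unitInterval : ∀ {N x d} → InUnitInterval x → (digits : IsNCFDigits N x d) →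
  ∀ n → InUnitInterval (IsNCFDigits.t digits n)
iterates-unitInterval {x = x} x∈I digits zero =
  InUnitInterval-resp {x} {t 0} (≃-sym {t 0} {x} t-start) x∈I
  where open IsNCFDigits digits
iterates-unitInterval x∈I digits (suc n) = TGraph-unitInterval (IsNCFDigits.t-step digits n)

-- Here s and t approximate N / T^n(x) and T^n(x): if s stayed below N by a fixed δ, then so would s t.
quotient-gap : ∀ n s t δ η → 0ℚ ℚ.≤ n → 0ℚ ℚ.< η → η ℚ.* (n ℚ.+ (1ℚ ℚ.+ (1ℚ ℚ.+ (1ℚ ℚ.+ 1ℚ)))) ≡ δ →
  0ℚ ℚ.≤ s ℚ.+ η → s ℚ.+ δ ℚ.≤ n → 0ℚ ℚ.≤ t ℚ.+ 1ℚ → t ℚ.≤ 1ℚ ℚ.+ η → ¬ (n ℚ.≤ s ℚ.* t ℚ.+ η)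
quotient-gap n s t δ η 0≤n η>0 η-eq 0≤s+η s+δ≤n 0≤t+1 t≤1+η n≤st+η = ℚ.<-irrefl refl (begin-strict
  s ℚ.+ δ
    ≤⟨ s+δ≤n ⟩
  n
    ≤⟨ n≤st+η ⟩
  s ℚ.* t ℚ.+ η
    -- Passing to s + η, which is nonnegative, allows multiplication of the bound on t. The
    -- correction is at most 2η because t ≥ -1.
    ≡⟨ solve 3 (λ s t η → s :* t :+ η := (s :+ η) :* t :+ (η :* (con 1ℚ :+ con 1ℚ) :- η :* (t :+ con 1ℚ))) refl s t η ⟩
  (s ℚ.+ η) ℚ.* t ℚ.+ (η ℚ.* (1ℚ ℚ.+ 1ℚ) ℚ.- η ℚ.* (t ℚ.+ 1ℚ))
    ≤⟨ ℚ.+-mono-≤ (ℚ.*-monoˡ-≤-nonNeg (s ℚ.+ η) t≤1+η) (ℚ.+-monoʳ-≤ (η ℚ.* (1ℚ ℚ.+ 1ℚ)) (ℚ.neg-antimono-≤ η[t+1]≥0)) ⟩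
  (s ℚ.+ η) ℚ.* (1ℚ ℚ.+ η) ℚ.+ (η ℚ.* (1ℚ ℚ.+ 1ℚ) ℚ.- 0ℚ)
    ≡⟨ solve 2 (λ s η → (s :+ η) :* (con 1ℚ :+ η) :+ (η :* (con 1ℚ :+ con 1ℚ) :- con 0ℚ) := s :+ (η :* (con 1ℚ :+ (con 1ℚ :+ con 1ℚ)) :+ η :* (s :+ η))) refl s η ⟩
  s ℚ.+ (η ℚ.* (1ℚ ℚ.+ (1ℚ ℚ.+ 1ℚ)) ℚ.+ η ℚ.* (s ℚ.+ η))
    ≤⟨ ℚ.+-monoʳ-≤ s (ℚ.+-monoʳ-≤ (η ℚ.* (1ℚ ℚ.+ (1ℚ ℚ.+ 1ℚ))) (ℚ.*-monoˡ-≤-nonNeg η (ℚ.≤-trans (ℚ.+-monoʳ-≤ s η≤δ) s+δ≤n))) ⟩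
  s ℚ.+ (η ℚ.* (1ℚ ℚ.+ (1ℚ ℚ.+ 1ℚ)) ℚ.+ η ℚ.* n)
    ≡⟨ ℚ.+-identityʳ _ ⟨
  s ℚ.+ (η ℚ.* (1ℚ ℚ.+ (1ℚ ℚ.+ 1ℚ)) ℚ.+ η ℚ.* n) ℚ.+ 0ℚ
    <⟨ ℚ.+-monoʳ-< (s ℚ.+ (η ℚ.* (1ℚ ℚ.+ (1ℚ ℚ.+ 1ℚ)) ℚ.+ η ℚ.* n)) η>0 ⟩
  s ℚ.+ (η ℚ.* (1ℚ ℚ.+ (1ℚ ℚ.+ 1ℚ)) ℚ.+ η ℚ.* n) ℚ.+ η
    ≡⟨ solve 3 (λ s η n → s :+ (η :* (con 1ℚ :+ (con 1ℚ :+ con 1ℚ)) :+ η :* n) :+ η := s :+ η :* (n :+ (con 1ℚ :+ (con 1ℚ :+ (con 1ℚ :+ con 1ℚ))))) refl s η n ⟩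
  s ℚ.+ η ℚ.* (n ℚ.+ (1ℚ ℚ.+ (1ℚ ℚ.+ (1ℚ ℚ.+ 1ℚ))))
    ≡⟨ cong (λ q → s ℚ.+ q) η-eq ⟩
  s ℚ.+ δ ∎)
  where
  open ℚ.≤-Reasoning
  open +-*-Solver
  instance
    η-nonNeg : NonNegative η
    η-nonNeg = nonNegative (ℚ.<⇒≤ η>0)
    s+η-nonNeg : NonNegative (s ℚ.+ η)
    s+η-nonNeg = nonNegative 0≤s+η
  η[t+1]≥0 : 0ℚ ℚ.≤ η ℚ.* (t ℚ.+ 1ℚ)
  η[t+1]≥0 = subst (ℚ._≤ η ℚ.* (t ℚ.+ 1ℚ)) (ℚ.*-zeroʳ η) (ℚ.*-monoˡ-≤-nonNeg η 0≤t+1)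
  η≤δ : η ℚ.≤ δ
  η≤δ = begin
    η              ≡⟨ ℚ.*-identityʳ η ⟨
    η ℚ.* (0ℚ ℚ.+ (1ℚ ℚ.+ 0ℚ))
                   ≤⟨ ℚ.*-monoˡ-≤-nonNeg η (ℚ.+-mono-≤ 0≤n (ℚ.+-monoʳ-≤ 1ℚ (ℚ.nonNegative⁻¹ (1ℚ ℚ.+ (1ℚ ℚ.+ 1ℚ))))) ⟩
    η ℚ.* (n ℚ.+ (1ℚ ℚ.+ (1ℚ ℚ.+ (1ℚ ℚ.+ 1ℚ))))
                   ≡⟨ η-eq ⟩
    δ              ∎

-- If d < N, then z < d + 1 ≤ N with a fixed gap δ, whereas z t = N and t ≤ 1 do not allow z to stay
-- below N. All approximations are compared at one common index m.
N≤digit : ∀ {N t d z} → InUnitInterval t → IsQuotient (fromℤ (+ N)) t z → IsFloor z (+ d) → N ℕ.≤ d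
N≤digit {N} {t} {d} {z} (0≤t , t≤1) (_ , zt≃N) (d≤z , (δ , δ>0 , M₁ , z+δ≤)) = ℕ.≮⇒≥ λ d<N →
  let
    M₂ , z≥  = d≤z η η>0
    M₃ , t≥  = 0≤t 1ℚ (ℚ.positive⁻¹ 1ℚ)
    M₄ , t≤  = t≤1 η η>0
    M₅ , zt≥ = ≃⇒≤ {fromℤ (+ N)} {z * t} (≃-sym {z * t} {fromℤ (+ N)} zt≃N) η η>0
    m = M₁ ℕ.+ (M₂ ℕ.+ (M₃ ℕ.+ (M₄ ℕ.+ M₅)))
    M₁≤m = ℕ.m≤m+n M₁ _
    M₂≤m = ℕ.≤-trans (ℕ.m≤m+n M₂ _) (ℕ.m≤n+m _ M₁)
    M₃≤m = ℕ.≤-trans (ℕ.m≤m+n M₃ _) (ℕ.≤-trans (ℕ.m≤n+m _ M₂) (ℕ.m≤n+m _ M₁))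
    M₄≤m = ℕ.≤-trans (ℕ.m≤m+n M₄ _) (ℕ.≤-trans (ℕ.m≤n+m _ M₃) (ℕ.≤-trans (ℕ.m≤n+m _ M₂) (ℕ.m≤n+m _ M₁)))
    M₅≤m = ℕ.≤-trans (ℕ.m≤n+m M₅ M₄) (ℕ.≤-trans (ℕ.m≤n+m _ M₃) (ℕ.≤-trans (ℕ.m≤n+m _ M₂) (ℕ.m≤n+m _ M₁)))
  in quotient-gap n (seq z m) (seq t m) δ η (0≤k/1 N) η>0 ηK≡δ
       (ℚ.≤-trans (0≤k/1 d) (z≥ m M₂≤m))
       (ℚ.≤-trans (z+δ≤ m M₁≤m) (i≤j⇒i/1≤j/1 (+ d ℤ.+ 1ℤ) (+ N) (ℤ.+≤+ (subst (ℕ._≤ N) (ℕ.+-comm 1 d) d<N))))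
       (t≥ m M₃≤m) (t≤ m M₄≤m) (zt≥ m M₅≤m)
  where
  0≤k/1 : ∀ k → 0ℚ ℚ.≤ + k ℚ./ 1
  0≤k/1 k = i≤j⇒i/1≤j/1 (+ 0) (+ k) (ℤ.+≤+ ℕ.z≤n)
  n K η : ℚ
  n = + N ℚ./ 1
  K = n ℚ.+ (1ℚ ℚ.+ (1ℚ ℚ.+ (1ℚ ℚ.+ 1ℚ)))
  instance
    K-pos : Positive K
    K-pos = positive (ℚ.+-mono-≤-< (0≤k/1 N) (ℚ.positive⁻¹ (1ℚ ℚ.+ (1ℚ ℚ.+ (1ℚ ℚ.+ 1ℚ)))))
    K-nonZero : ℚ.NonZero K
    K-nonZero = ℚ.pos⇒nonZero K
    1/K-pos : Positive (ℚ.1/ K)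
    1/K-pos = ℚ.1/pos⇒pos K
  -- The precision is chosen so that η (N + 4) = δ, as `quotient-gap` requires.
  η = δ ℚ.* ℚ.1/ K
  ηK≡δ : η ℚ.* K ≡ δ
  ηK≡δ = trans (ℚ.*-assoc δ (ℚ.1/ K) K) (trans (cong (λ q → δ ℚ.* q) (ℚ.*-inverseˡ K)) (ℚ.*-identityʳ δ))
  η>0 : 0ℚ ℚ.< η
  η>0 = subst (ℚ._< η) (ℚ.*-zeroˡ (ℚ.1/ K)) (ℚ.*-monoˡ-<-pos (ℚ.1/ K) δ>0)

digits-≥ : ∀ {N x d} → InUnitInterval x → IsNCFDigits N x d → ∀ n → N ℕ.≤ d n
digits-≥ {d = d} x∈I digits n with z , quotient , floor ← IsNCFDigits.digit digits n =
  N≤digit {t = IsNCFDigits.t digits n} {d n} {z} (iterates-unitInterval x∈I digits n) quotient floor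

-- Uniform frequencies for ω and its orbit closure

-- The estimates concern `W 0`, which equals ω pointwise. Hence factors of ω, and by
-- `orbit-closure-factors` those of the elements of its orbit closure, are factors of `W 0`.
desubstitutable⇒uniformWordFrequency : ∀ {N s ω} → 2 ℕ.≤ N → (∀ n → HasIncidence N (s n)) → IsDesubstitutable s ω →
  HasUniformWordFrequency ω × (∀ μ → X ω μ → HasUniformWordFrequency μ)
desubstitutable⇒uniformWordFrequency {ω = ω} 2≤N inc desub@(W , W₀≗ω , _) =
  transfer (λ k l → k , applyUpTo-cong l (λ {i} _ → sym (W₀≗ω (k ℕ.+ i)))) ,
  λ μ μ∈X → transfer (λ k l → let k′ , eq = orbit-closure-factors μ∈X k l in
    k′ , trans eq (applyUpTo-cong l (λ {i} _ → sym (W₀≗ω (k′ ℕ.+ i)))))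
  where
  transfer : ∀ {μ} → FactorsOf (W 0) μ → HasUniformWordFrequency μ
  transfer = uniformlyCauchy⇒uniformWordFrequency {W 0}
    (λ u → frequenciesAgree⇒uniformlyCauchy {u} {W 0} (desubstitutable⇒frequenciesAgree u 2≤N inc desub))

corollary5p16 : (N : ℕ) → 2 ℕ.≤ N →
    (x : ℝ) → 0ℝ ≤ x → x ≤ 1ℝ → Irrational x →
    ((ω : Sequence) → IsNCFSequence N x ω →
    HasUniformWordFrequency ω ×
    ((μ : Sequence) → X ω μ → HasUniformWordFrequency μ)) ×
    ((ω̂ : Sequence) → IsDualNCFSequence N x ω̂ →
    HasUniformWordFrequency ω̂ ×
    ((μ : Sequence) → X ω̂ μ → HasUniformWordFrequency μ))
corollary5p16 N 2≤N x 0≤x x≤1 _ =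
  (λ ω (d , digits , desub) → desubstitutable⇒uniformWordFrequency 2≤N (λ n → σ-incidence 1≤N (digits-≥ (0≤x , x≤1) digits n)) desub) ,
  (λ ω̂ (d , digits , desub) → desubstitutable⇒uniformWordFrequency 2≤N (λ n → σ̂-incidence 1≤N (digits-≥ (0≤x , x≤1) digits n)) desub)
  where
  1≤N : 1 ℕ.≤ N
  1≤N = ℕ.≤-trans (ℕ.s≤s ℕ.z≤n) 2≤N
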